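{- Let $\mu$ be any (Borel) measure on $\mathbb R$. For every $n\in\mathbb N$, let the partition $P_n$ consist of all integer multiples of $1/2^n$ between $-n$ and $n$. The minimal valuation $i[\mu]$ (on $\mathbf I\mathbb R$, resp. $\mathbf I\mathbb R_\bot$) is the supremum of the countable chain of simple valuations $\mu_{P_n}$, $n\in\mathbb N$.
   Context: $\overline{\mathbb R}_+=[0,+\infty]$. $\mathbf I\mathbb R$ is the dcpo of closed intervals $[a,b]$ with $a,b\in\mathbb R$, $a\le b$, ordered by reverse inclusion $\supseteq$; $\mathbf I\mathbb R_\bot$ is $\mathbf I\mathbb R$ with a fresh least element $\bot$ added. Both have their Scott topology. $i\colon\mathbb R\to\mathbf I\mathbb R$ (resp. $\mathbf I\mathbb R_\bot$) is the embedding $a\mapsto[a,a]$. A continuous valuation on a space $X$ is a Scott-continuous map $\nu\colon\mathcal O X\to\overline{\mathbb R}_+$ on the lattice of open sets with $\nu(\emptyset)=0$ and $\nu(U\cup V)+\nu(U\cap V)=\nu(U)+\nu(V)$; continuous valuations are ordered pointwise and form a dcpo $\mathbf V X$. Every Borel measure $\mu$ on $\mathbb R$ (values in $\overline{\mathbb R}_+$, no finiteness assumption) restricts to a continuous valuation on $\mathbb R$, and $i[\mu](V)=\mu(i^{ -1}(V))$ is its image valuation. Minimal valuations on $X$ are the elements of the smallest subset of $\mathbf V X$ that contains all finite linear combinations $\sum r_i\delta_{x_i}$ ($r_i\in\mathbb R_+$) of Dirac valuations and is closed under directed suprema taken in $\mathbf V X$. A partition of $\mathbb R$ is a finite non-empty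 subset $P=\{a_1<\cdots<a_n\}$ of $\mathbb R$ ($n\ge1$), and $\mu_P=\sum_{i=2}^n\mu(]a_{i-1},a_i])\,\delta_{[a_{i-1},a_i]}$. In this statement "simple valuation" for $\mu_{P_n}$ just refers to this finite linear combination of Dirac valuations; its coefficients $\mu(]a_{i-1},a_i])$ are elements of $\overline{\mathbb R}_+$. -}

module Defs where

open import Data.Empty using (⊥-elim)
open import Data.Integer.Base as ℤ using (ℤ; +_)
import Data.Integer.Properties as ℤ
open import Data.List.Base using (List; []; _∷_; foldr; map; applyUpTo)
open import Data.List.Relation.Unary.All using (All)
open import Data.List.Relation.Unary.Linked using (Linked; []; [-]; _∷_)
open import Data.List.Relation.Unary.Linked.Properties using (applyUpTo⁺₂)
open import Data.Nat.Base as ℕ using (ℕ; zero; suc; NonZero; _^_)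
import Data.Nat.Properties as ℕ
open import Data.Product.Base using (Σ; ∃; ∃₂; _×_; _,_; proj₁; proj₂)
open import Data.Rational.Base as ℚ using (ℚ; 0ℚ; 1ℚ; fromℚᵘ)
import Data.Rational.Properties as ℚ
open import Data.Rational.Unnormalised.Base as ℚᵘ using (mkℚᵘ; *<*)
import Data.Rational.Unnormalised.Properties as ℚᵘ
open import Data.Sum.Base using (_⊎_; inj₁; inj₂)
open import Function.Base using (_∘_)
open import Function.Bundles using (_⇔_; Equivalence; mk⇔)
open import Level using (Level; _⊔_; 0ℓ; Lift; lift; lower) renaming (suc to lsuc)
open import Relation.Binary.Bundles using (Poset)
open import Relation.Binary.Construct.Add.Infimum.NonStrict
  using (_≤₋_; ⊥₋≤_; [_]; ≤₋-isPartialOrder)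
import Relation.Binary.Construct.Flip.EqAndOrd as Flip
import Relation.Binary.Construct.On as On
open import Relation.Binary.Definitions using (tri<; tri≈; tri>)
open import Relation.Binary.PropositionalEquality.Core
  using (_≡_; _≢_; refl; sym; cong; subst; subst₂)
open import Relation.Nullary.Construct.Add.Infimum using (_₋; ⊥₋; [_])
open import Relation.Nullary.Negation.Core using (¬_)
open import Relation.Unary
  using (Pred; _∈_; _∉_; _⊆′_; _≐_; _∪_; _∩_; ∁; ⋃; ⋂; _⊢_; ∅; Satisfiable) renaming (_⊥_ to Disjoint)
open import Relation.Unary.Relation.Binary.Subset using (⊆′-poset)

private
  variable
    i j c ℓ₁ ℓ₂ d ℓ₃ ℓ₄ : Level

------------------------------------------------------------------------
-- Directed suprema.  A directed subset D of P is presented as a directed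
-- family I → P; taking I = Σ P D with the family proj₁ shows that families
-- indexed at the level of the carrier account for all subsets.

module _ (P : Poset c ℓ₁ ℓ₂) where
  open Poset P

  record IsDirected {I : Set i} (f : I → Carrier) : Set (i ⊔ ℓ₂) where
    field
      inhabitant : I
      bound      : ∀ k l → ∃ λ m → f k ≤ f m × f l ≤ f m

  record IsLub {I : Set i} (f : I → Carrier) (s : Carrier) : Set (i ⊔ c ⊔ ℓ₂) where
    field
      upper : ∀ k → f k ≤ s
      least : ∀ {t} → (∀ k → f k ≤ t) → s ≤ t

  record IsScottOpen (V : Pred Carrier 0ℓ) : Set (lsuc c ⊔ ℓ₂) where
    field
      upward       : ∀ {x y} → x ≤ y → x ∈ V → y ∈ V
      inaccessible : ∀ {I : Set c} {f : I → Carrier} {s} →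
                     IsDirected f → IsLub f s → s ∈ V → ∃ λ k → f k ∈ V

record IsScottContinuous (P : Poset c ℓ₁ ℓ₂) (Q : Poset d ℓ₃ ℓ₄)
                         (f : Poset.Carrier P → Poset.Carrier Q) :
                         Set (lsuc c ⊔ ℓ₂ ⊔ d ⊔ ℓ₄) where
  private
    module P = Poset P
    module Q = Poset Q
  field
    mono         : ∀ {x y} → x P.≤ y → f x Q.≤ f y
    preservesLub : ∀ {I : Set c} {g : I → P.Carrier} {s} →
                   IsDirected P g → IsLub P g s → IsLub Q (f ∘ g) (f s)

------------------------------------------------------------------------
-- [0, +∞], an element being represented by the set of rationals strictly
-- below it (so every negative rational belongs to it, and +∞ is all of ℚ).

record [0,∞] : Set₁ where
  field
    Below    : Pred ℚ 0ℓ
    negative : ∀ {q} → q ℚ.< 0ℚ → q ∈ Below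
    rounded  : ∀ {q} → q ∈ Below ⇔ ∃ λ r → q ℚ.< r × r ∈ Below

open [0,∞] using (Below)

[0,∞]-poset : Poset _ _ _
[0,∞]-poset = On.poset (⊆′-poset ℚ 0ℓ) Below

open Poset [0,∞]-poset public
  using () renaming (_≈_ to _≈∞_; _≤_ to _≤∞_)

Finite : [0,∞] → Set
Finite r = ∃ λ q → q ∉ Below r

private
  belowℚ : (r : ℚ) → 0ℚ ℚ.≤ r → [0,∞]
  belowℚ r 0≤r = record
    { Below    = ℚ._< r
    ; negative = λ q<0 → ℚ.<-≤-trans q<0 0≤r
    ; rounded  = mk⇔ ℚ.<-dense (λ (_ , q<s , s<r) → ℚ.<-trans q<s s<r)
    }

0∞ 1∞ : [0,∞]
0∞ = belowℚ 0ℚ ℚ.≤-refl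
1∞ = belowℚ 1ℚ (ℚ.nonNegative⁻¹ 1ℚ)

infixl 6 _+∞_
infixl 7 _·∞_

_+∞_ : [0,∞] → [0,∞] → [0,∞]
r +∞ s = record
  { Below    = λ q → ∃₂ λ a b → a ∈ Below r × b ∈ Below s × q ℚ.< a ℚ.+ b
  ; negative = λ q<0 → negative+ q<0
  ; rounded  = mk⇔
      (λ (a , b , a∈ , b∈ , q<) → let t , q<t , t< = ℚ.<-dense q< in
        t , q<t , a , b , a∈ , b∈ , t<)
      (λ (_ , q<t , a , b , a∈ , b∈ , t<) → a , b , a∈ , b∈ , ℚ.<-trans q<t t<)
  }
  where
  negative+ : ∀ {q} → q ℚ.< 0ℚ →
              ∃₂ λ a b → a ∈ Below r × b ∈ Below s × q ℚ.< a ℚ.+ b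
  negative+ {q} q<0 =
    let a , q<a , a<0 = ℚ.<-dense q<0
        q-a<0 = subst (q ℚ.- a ℚ.<_) (ℚ.+-inverseʳ a) (ℚ.+-monoˡ-< (ℚ.- a) q<a)
        b , q-a<b , b<0 = ℚ.<-dense q-a<0
    in a , b , [0,∞].negative r a<0 , [0,∞].negative s b<0 ,
       subst (ℚ._< a ℚ.+ b) (cancel a) (ℚ.+-monoʳ-< a q-a<b)
    where
    open import Relation.Binary.PropositionalEquality using (module ≡-Reasoning)
    open ≡-Reasoning
    cancel : ∀ a → a ℚ.+ (q ℚ.- a) ≡ q
    cancel a = begin
      a ℚ.+ (q ℚ.- a)       ≡⟨ cong (a ℚ.+_) (ℚ.+-comm q (ℚ.- a)) ⟩
      a ℚ.+ (ℚ.- a ℚ.+ q)   ≡⟨ ℚ.+-assoc a (ℚ.- a) q ⟨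
      (a ℚ.- a) ℚ.+ q       ≡⟨ cong (ℚ._+ q) (ℚ.+-inverseʳ a) ⟩
      0ℚ ℚ.+ q              ≡⟨ ℚ.+-identityˡ q ⟩
      q                     ∎

-- The convention 0 · ∞ = 0 holds: 0 has no nonnegative rational below it.
_·∞_ : [0,∞] → [0,∞] → [0,∞]
r ·∞ s = record
  { Below    = λ q → q ℚ.< 0ℚ ⊎
      ∃₂ λ a b → (0ℚ ℚ.≤ a × a ∈ Below r) × (0ℚ ℚ.≤ b × b ∈ Below s) × q ℚ.< a ℚ.* b
  ; negative = inj₁
  ; rounded  = mk⇔
      (λ { (inj₁ q<0) → let t , q<t , t<0 = ℚ.<-dense q<0 in t , q<t , inj₁ t<0
         ; (inj₂ (a , b , a∈ , b∈ , q<)) → let t , q<t , t< = ℚ.<-dense q< in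
             t , q<t , inj₂ (a , b , a∈ , b∈ , t<) })
      (λ { (_ , q<t , inj₁ t<0) → inj₁ (ℚ.<-trans q<t t<0)
         ; (_ , q<t , inj₂ (a , b , a∈ , b∈ , t<)) →
             inj₂ (a , b , a∈ , b∈ , ℚ.<-trans q<t t<) })
  }

partialSum : (ℕ → [0,∞]) → ℕ → [0,∞]
partialSum a zero    = 0∞
partialSum a (suc n) = partialSum a n +∞ a n

------------------------------------------------------------------------
-- ℝ: two-sided Dedekind cuts

record ℝ : Set₁ where
  field
    Lower Upper : Pred ℚ 0ℓ
    lowerInhabited : Satisfiable Lower
    upperInhabited : Satisfiable Upper
    lowerRounded   : ∀ {q} → q ∈ Lower ⇔ ∃ λ r → q ℚ.< r × r ∈ Lower
    upperRounded   : ∀ {r} → r ∈ Upper ⇔ ∃ λ q → q ℚ.< r × q ∈ Upper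
    disjoint       : ∀ {q} → ¬ (q ∈ Lower × q ∈ Upper)
    located        : ∀ {q r} → q ℚ.< r → q ∈ Lower ⊎ r ∈ Upper

open ℝ

infix 4 _≤ᴿ_ _<ᴿ_

_≤ᴿ_ _<ᴿ_ : ℝ → ℝ → Set
x ≤ᴿ y = Lower x ⊆′ Lower y
x <ᴿ y = ∃ λ q → q ∈ Upper x × q ∈ Lower y

ratᴿ : ℚ → ℝ
ratᴿ p = record
  { Lower = ℚ._< p
  ; Upper = p ℚ.<_
  ; lowerInhabited = p ℚ.- 1ℚ ,
      subst (p ℚ.- 1ℚ ℚ.<_) (ℚ.+-identityʳ p) (ℚ.+-monoʳ-< p (ℚ.negative⁻¹ (ℚ.- 1ℚ)))
  ; upperInhabited = p ℚ.+ 1ℚ ,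
      subst (ℚ._< p ℚ.+ 1ℚ) (ℚ.+-identityʳ p) (ℚ.+-monoʳ-< p (ℚ.positive⁻¹ 1ℚ))
  ; lowerRounded = mk⇔ ℚ.<-dense (λ (_ , q<r , r<p) → ℚ.<-trans q<r r<p)
  ; upperRounded = mk⇔ (λ p<r → let q , p<q , q<r = ℚ.<-dense p<r in q , q<r , p<q)
                       (λ (_ , q<r , p<q) → ℚ.<-trans p<q q<r)
  ; disjoint = λ (q<p , p<q) → ℚ.<-asym q<p p<q
  ; located  = λ q<r → ratLocated q<r
  }
  where
  ratLocated : ∀ {q r} → q ℚ.< r → q ℚ.< p ⊎ p ℚ.< r
  ratLocated {q} {r} q<r with ℚ.<-cmp q p
  ... | tri< q<p _ _ = inj₁ q<p
  ... | tri≈ _ q≡p _ = inj₂ (subst (ℚ._< r) q≡p q<r)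
  ... | tri> _ _ p<q = inj₂ (ℚ.<-trans p<q q<r)

≤ᴿ-refl : ∀ x → x ≤ᴿ x
≤ᴿ-refl _ _ q∈x = q∈x

lower<upper : ∀ (x : ℝ) {q r} → q ∈ Lower x → r ∈ Upper x → q ℚ.< r
lower<upper x {q} {r} q∈ r∈ with ℚ.<-cmp q r
... | tri< q<r _ _  = q<r
... | tri≈ _ refl _ = ⊥-elim (disjoint x (q∈ , r∈))
... | tri> _ _ r<q  = ⊥-elim (disjoint x (Equivalence.from (lowerRounded x) (q , r<q , q∈) , r∈))

<⇒≤ᴿ : ∀ {x y} → x <ᴿ y → x ≤ᴿ y
<⇒≤ᴿ {x} {y} (r , r∈x , r∈y) _ q∈x =
  Equivalence.from (lowerRounded y) (r , lower<upper x q∈x r∈x , r∈y)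

ratᴿ-mono-< : ∀ {p q} → p ℚ.< q → ratᴿ p <ᴿ ratᴿ q
ratᴿ-mono-< = ℚ.<-dense

------------------------------------------------------------------------
-- Borel measures on ℝ

IsOpenᴿ : Pred ℝ 0ℓ → Set₁
IsOpenᴿ A = ∀ x → x ∈ A →
  ∃₂ λ a b → a <ᴿ x × x <ᴿ b × (∀ y → a <ᴿ y → y <ᴿ b → y ∈ A)

-- Closure under ⋂ would follow from the other clauses by excluded middle.
-- The clause resp is closure under equality of subsets.
data IsBorel : Pred ℝ 0ℓ → Set₁ where
  open-set     : ∀ {A} → IsOpenᴿ A → IsBorel A
  complement   : ∀ {A} → IsBorel A → IsBorel (∁ A)
  union        : ∀ {A : ℕ → Pred ℝ 0ℓ} → (∀ n → IsBorel (A n)) → IsBorel (⋃ ℕ A)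
  intersection : ∀ {A : ℕ → Pred ℝ 0ℓ} → (∀ n → IsBorel (A n)) → IsBorel (⋂ ℕ A)
  resp         : ∀ {A B} → A ≐ B → IsBorel A → IsBorel B

BorelSet : Set₁
BorelSet = ∃ IsBorel

⋃ᴮ : (ℕ → BorelSet) → BorelSet
⋃ᴮ A = ⋃ ℕ (proj₁ ∘ A) , union (proj₂ ∘ A)

∅ᴮ : BorelSet
∅ᴮ = ∅ , open-set λ _ ()

record Measure : Set₁ where
  field
    measure  : BorelSet → [0,∞]
    measure-cong : ∀ {A B} → proj₁ A ≐ proj₁ B → measure A ≈∞ measure B
    measure-∅ : measure ∅ᴮ ≈∞ 0∞
    measure-⋃ : ∀ (A : ℕ → BorelSet) →
                (∀ m n → m ≢ n → Disjoint (proj₁ (A m)) (proj₁ (A n))) →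
                IsLub [0,∞]-poset (partialSum (measure ∘ A)) (measure (⋃ᴮ A))

open Measure

]_,_] : ℝ → ℝ → Pred ℝ 0ℓ
] a , b ] = λ x → a <ᴿ x × x ≤ᴿ b

above-open : ∀ a → IsOpenᴿ (a <ᴿ_)
above-open a x a<x =
  let r , r∈x = upperInhabited x
      q , q<r , q∈x = Equivalence.to (upperRounded x) r∈x
  in a , ratᴿ r , a<x , (q , q∈x , q<r) , λ _ a<y _ → a<y

≤ᴿ⇔≯ᴿ : ∀ {x b} → (x ≤ᴿ b) ⇔ (¬ (b <ᴿ x))
≤ᴿ⇔≯ᴿ {x} {b} = mk⇔
  (λ x≤b (q , q∈b , q∈x) → disjoint b (x≤b q q∈x , q∈b))
  from
  where
  from : ¬ (b <ᴿ x) → x ≤ᴿ b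
  from b≮x q q∈x with Equivalence.to (lowerRounded x) q∈x
  ... | r , q<r , r∈x with located b q<r
  ...   | inj₁ q∈b = q∈b
  ...   | inj₂ r∈b = ⊥-elim (b≮x (r , r∈b , r∈x))

]]-borel : ∀ a b → IsBorel ] a , b ]
]]-borel a b = resp
  ( (λ {x} h → h 0 , Equivalence.from (≤ᴿ⇔≯ᴿ {x} {b}) (h 1))
  , (λ { {x} (a<x , x≤b) zero    → a<x
       ; {x} (a<x , x≤b) (suc _) → Equivalence.to (≤ᴿ⇔≯ᴿ {x} {b}) x≤b }))
  (intersection {A = half} half-borel)
  where
  half : ℕ → Pred ℝ 0ℓ
  half zero    = a <ᴿ_
  half (suc _) = ∁ (b <ᴿ_)
  half-borel : ∀ n → IsBorel (half n)
  half-borel zero    = open-set {A = a <ᴿ_} (above-open a)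
  half-borel (suc _) = complement (open-set {A = b <ᴿ_} (above-open b))

------------------------------------------------------------------------
-- Scott-open sets and continuous valuations

module _ (X : Poset c ℓ₁ ℓ₂) where
  open Poset X using (Carrier)

  ScottOpen : Set _
  ScottOpen = ∃ (IsScottOpen X)

  ScottOpen-poset : Poset _ _ _
  ScottOpen-poset = On.poset (⊆′-poset Carrier 0ℓ) (proj₁ {B = IsScottOpen X})

module _ {X : Poset c ℓ₁ ℓ₂} where
  open IsScottOpen
  open IsDirected
  private module X = Poset X

  ∅ˢ : ScottOpen X
  ∅ˢ = ∅ , record { upward = λ _ () ; inaccessible = λ _ _ () }

  _∪ˢ_ _∩ˢ_ : ScottOpen X → ScottOpen X → ScottOpen X
  (V , V-open) ∪ˢ (W , W-open) = V ∪ W , record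
    { upward = λ { x≤y (inj₁ x∈V) → inj₁ (upward V-open x≤y x∈V)
                 ; x≤y (inj₂ x∈W) → inj₂ (upward W-open x≤y x∈W) }
    ; inaccessible = λ
        { dir lub (inj₁ s∈V) → let k , k∈ = inaccessible V-open dir lub s∈V in k , inj₁ k∈
        ; dir lub (inj₂ s∈W) → let k , k∈ = inaccessible W-open dir lub s∈W in k , inj₂ k∈ }
    }
  (V , V-open) ∩ˢ (W , W-open) = V ∩ W , record
    { upward = λ x≤y (x∈V , x∈W) → upward V-open x≤y x∈V , upward W-open x≤y x∈W
    ; inaccessible = λ dir lub (s∈V , s∈W) →
        let k , k∈ = inaccessible V-open dir lub s∈V
            l , l∈ = inaccessible W-open dir lub s∈W
            m , k≤m , l≤m = bound dir k l
        in m , upward V-open k≤m k∈ , upward W-open l≤m l∈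
    }

SetFunction : Poset c ℓ₁ ℓ₂ → Set _
SetFunction X = ScottOpen X → [0,∞]

record IsContinuousValuation (X : Poset c ℓ₁ ℓ₂) (ν : SetFunction X) :
                             Set (lsuc (lsuc c) ⊔ lsuc ℓ₂) where
  field
    continuous : IsScottContinuous (ScottOpen-poset X) [0,∞]-poset ν
    strict     : ν ∅ˢ ≈∞ 0∞
    modular    : ∀ V W → ν (V ∪ˢ W) +∞ ν (V ∩ˢ W) ≈∞ ν V +∞ ν W

𝐕 : Poset c ℓ₁ ℓ₂ → Poset _ _ _
𝐕 X = record
  { Carrier = ∃ (IsContinuousValuation X)
  ; _≈_ = λ ν ξ → ∀ V → proj₁ ν V ≈∞ proj₁ ξ V
  ; _≤_ = λ ν ξ → ∀ V → proj₁ ν V ≤∞ proj₁ ξ V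
  ; isPartialOrder = record
    { isPreorder = record
      { isEquivalence = record
        { refl  = λ {ν} V → ∞.Eq.refl {proj₁ ν V}
        ; sym   = λ {ν} {ξ} ν≈ξ V → ∞.Eq.sym {proj₁ ν V} {proj₁ ξ V} (ν≈ξ V)
        ; trans = λ {ν} {ξ} {ζ} ν≈ξ ξ≈ζ V →
            ∞.Eq.trans {proj₁ ν V} {proj₁ ξ V} {proj₁ ζ V} (ν≈ξ V) (ξ≈ζ V)
        }
      ; reflexive = λ {ν} {ξ} ν≈ξ V → ∞.reflexive {proj₁ ν V} {proj₁ ξ V} (ν≈ξ V)
      ; trans     = λ {ν} {ξ} {ζ} ν≤ξ ξ≤ζ V →
          ∞.trans {proj₁ ν V} {proj₁ ξ V} {proj₁ ζ V} (ν≤ξ V) (ξ≤ζ V)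
      }
    ; antisym = λ {ν} {ξ} ν≤ξ ξ≤ν V → ∞.antisym {proj₁ ν V} {proj₁ ξ V} (ν≤ξ V) (ξ≤ν V)
    }
  }
  where module ∞ = Poset [0,∞]-poset

module _ {X : Poset c ℓ₁ ℓ₂} where
  open Poset X using (Carrier)

  -- Below (δ x V) is {q < 1} if x ∈ V and {q < 0} otherwise.
  δ : Carrier → SetFunction X
  δ x (V , _) = record
    { Below    = λ q → q ℚ.< 0ℚ ⊎ (q ℚ.< 1ℚ × x ∈ V)
    ; negative = inj₁
    ; rounded  = mk⇔
        (λ { (inj₁ q<0) → let t , q<t , t<0 = ℚ.<-dense q<0 in t , q<t , inj₁ t<0
           ; (inj₂ (q<1 , x∈V)) → let t , q<t , t<1 = ℚ.<-dense q<1 in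
               t , q<t , inj₂ (t<1 , x∈V) })
        (λ { (_ , q<t , inj₁ t<0) → inj₁ (ℚ.<-trans q<t t<0)
           ; (_ , q<t , inj₂ (t<1 , x∈V)) → inj₂ (ℚ.<-trans q<t t<1 , x∈V) })
    }

  linearCombination : List ([0,∞] × Carrier) → SetFunction X
  linearCombination rxs V = foldr (λ (r , x) s → r ·∞ δ x V +∞ s) 0∞ rxs

  -- The index level of directedSup is that of the carrier of 𝐕 X.
  data IsMinimal : Poset.Carrier (𝐕 X) → Set (lsuc (lsuc (lsuc c ⊔ ℓ₂))) where
    simple : ∀ {ν} (rxs : List ([0,∞] × Carrier)) → All (Finite ∘ proj₁) rxs →
             (∀ V → proj₁ ν V ≈∞ linearCombination rxs V) → IsMinimal ν
    directedSup : ∀ {I : Set (lsuc (lsuc c ⊔ ℓ₂))} {ν} (f : I → Poset.Carrier (𝐕 X)) →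
                  IsDirected (𝐕 X) f → IsLub (𝐕 X) f ν →
                  (∀ k → IsMinimal (f k)) → IsMinimal ν

------------------------------------------------------------------------
-- 𝐈ℝ and 𝐈ℝ⊥

record Interval : Set₁ where
  constructor interval
  field
    lo hi : ℝ
    lo≤hi : lo ≤ᴿ hi

open Interval

points : Interval → Pred ℝ 0ℓ
points J x = lo J ≤ᴿ x × x ≤ᴿ hi J

𝐈ℝ : Poset _ _ _
𝐈ℝ = Flip.poset (On.poset (⊆′-poset ℝ 0ℓ) points)

𝐈ℝ⊥ : Poset _ _ _
𝐈ℝ⊥ = record { isPartialOrder = ≤₋-isPartialOrder _ (Poset.isPartialOrder 𝐈ℝ) }

ι : ℝ → Interval
ι a = interval a a (≤ᴿ-refl a)

inj : Interval → Interval ₋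
inj J = [ J ]

ι⊥ : ℝ → Interval ₋
ι⊥ = inj ∘ ι

IsContinuousᴿ : (X : Poset c ℓ₁ ℓ₂) → (ℝ → Poset.Carrier X) → Set _
IsContinuousᴿ X f = ∀ ((V , _) : ScottOpen X) → IsOpenᴿ (f ⊢ V)

-- ι x is the directed supremum of the rational intervals around x, so one of
-- these belongs to V as soon as ι x does.
ι-continuous : IsContinuousᴿ 𝐈ℝ ι
ι-continuous (V , V-open) x x∈V =
  let lift (p , q , p∈x , q∈x) , pq∈V = inaccessible around-directed around-lub x∈V
  in ratᴿ p , ratᴿ q
   , (let r , p<r , r∈x = Equivalence.to (lowerRounded x) p∈x in r , p<r , r∈x)
   , (let r , r<q , r∈x = Equivalence.to (upperRounded x) q∈x in r , r∈x , r<q)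
   , λ y p<y y<q → upward
       (λ z (y≤z , z≤y) → (λ r r<p → y≤z r (<⇒≤ᴿ {ratᴿ p} {y} p<y r r<p))
                        , (λ r r∈z → <⇒≤ᴿ {y} {ratᴿ q} y<q r (z≤y r r∈z)))
       pq∈V
  where
  open IsScottOpen V-open

  Around : Set₁
  Around = Lift (lsuc 0ℓ) (∃₂ λ p q → p ∈ Lower x × q ∈ Upper x)

  around : Around → Interval
  around (lift (p , q , p∈x , q∈x)) = interval (ratᴿ p) (ratᴿ q)
    (<⇒≤ᴿ {ratᴿ p} {ratᴿ q} (ratᴿ-mono-< (lower<upper x p∈x q∈x)))

  ⊔∈lower : ∀ {p q} → p ∈ Lower x → q ∈ Lower x → p ℚ.⊔ q ∈ Lower x
  ⊔∈lower {p} {q} p∈x q∈x with ℚ.⊔-sel p q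
  ... | inj₁ eq = subst (Lower x) (sym eq) p∈x
  ... | inj₂ eq = subst (Lower x) (sym eq) q∈x

  ⊓∈upper : ∀ {p q} → p ∈ Upper x → q ∈ Upper x → p ℚ.⊓ q ∈ Upper x
  ⊓∈upper {p} {q} p∈x q∈x with ℚ.⊓-sel p q
  ... | inj₁ eq = subst (Upper x) (sym eq) p∈x
  ... | inj₂ eq = subst (Upper x) (sym eq) q∈x

  around-directed : IsDirected 𝐈ℝ around
  around-directed = record
    { inhabitant =
        let p , p∈x = lowerInhabited x
            q , q∈x = upperInhabited x
        in lift (p , q , p∈x , q∈x)
    ; bound = λ (lift (p , q , p∈x , q∈x)) (lift (p′ , q′ , p′∈x , q′∈x)) →
        lift (p ℚ.⊔ p′ , q ℚ.⊓ q′ , ⊔∈lower p∈x p′∈x , ⊓∈upper q∈x q′∈x)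
        , (λ _ (l , u) → (λ r r<p → l r (ℚ.<-≤-trans r<p (ℚ.p≤p⊔q p p′)))
                       , (λ r r∈z → ℚ.<-≤-trans (u r r∈z) (ℚ.p⊓q≤p q q′)))
        , (λ _ (l , u) → (λ r r<p → l r (ℚ.<-≤-trans r<p (ℚ.p≤q⊔p p p′)))
                       , (λ r r∈z → ℚ.<-≤-trans (u r r∈z) (ℚ.p⊓q≤q q q′)))
    }

  around-lub : IsLub 𝐈ℝ around (ι x)
  around-lub = record
    { upper = λ (lift (p , q , p∈x , q∈x)) z (x≤z , z≤x) →
          (λ r r<p → x≤z r (Equivalence.from (lowerRounded x) (p , r<p , p∈x)))
        , (λ r r∈z → lower<upper x (z≤x r r∈z) q∈x)
    ; least = λ {J} h z z∈ →
          (λ r r∈x → let s , r<s , s∈x = Equivalence.to (lowerRounded x) r∈x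
                         q , q∈x = upperInhabited x
                     in proj₁ (h (lift (s , q , s∈x , q∈x)) z z∈) r r<s)
        , (λ r r∈z → below {J} h z z∈ r r∈z)
    }
    where
    below : ∀ {J} → (∀ k → Poset._≤_ 𝐈ℝ (around k) J) → ∀ z → z ∈ points J → z ≤ᴿ x
    below h z z∈ r r∈z =
      let s , r<s , s∈z = Equivalence.to (lowerRounded z) r∈z
          p , p∈x = lowerInhabited x
      in located-case s s∈z p p∈x (located x r<s)
      where
      located-case : ∀ s → s ∈ Lower z → ∀ p → p ∈ Lower x →
                     r ∈ Lower x ⊎ s ∈ Upper x → r ∈ Lower x
      located-case s s∈z p p∈x (inj₁ r∈x) = r∈x
      located-case s s∈z p p∈x (inj₂ s∈x) = ⊥-elim
        (ℚ.<-irrefl refl (proj₂ (h (lift (p , s , p∈x , s∈x)) z z∈) s s∈z))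

ι⊥-continuous : IsContinuousᴿ 𝐈ℝ⊥ ι⊥
ι⊥-continuous (V , V-open) = ι-continuous (inj ⊢ V , record
  { upward       = λ J≤K → upward [ J≤K ]
  ; inaccessible = λ dir lub → inaccessible (lift-directed dir) (lift-lub dir lub)
  })
  where
  open IsScottOpen V-open

  lift-directed : ∀ {I : Set₁} {f : I → Interval} →
                  IsDirected 𝐈ℝ f → IsDirected 𝐈ℝ⊥ (inj ∘ f)
  lift-directed dir = record
    { inhabitant = inhabitant
    ; bound      = λ k l → let m , k≤m , l≤m = bound k l in m , [ k≤m ] , [ l≤m ]
    }
    where open IsDirected dir

  lift-lub : ∀ {I : Set₁} {f : I → Interval} {J} →
             IsDirected 𝐈ℝ f → IsLub 𝐈ℝ f J → IsLub 𝐈ℝ⊥ (inj ∘ f) (inj J)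
  lift-lub {f = f} {J} dir lub = record
    { upper = λ k → [ IsLub.upper lub k ]
    ; least = least′
    }
    where
    bounds : ∀ {K} → (∀ k → Poset._≤_ 𝐈ℝ⊥ [ f k ] [ K ]) → ∀ k → Poset._≤_ 𝐈ℝ (f k) K
    bounds h k with h k
    ... | [ fk≤K ] = fk≤K
    least′ : ∀ {t} → (∀ k → Poset._≤_ 𝐈ℝ⊥ [ f k ] t) → Poset._≤_ 𝐈ℝ⊥ [ J ] t
    least′ {[ K ]} h = [ IsLub.least lub {K} (bounds {K} h) ]
    least′ {⊥₋} h with h (IsDirected.inhabitant dir)
    ... | ()

-- The image under f of the restriction of μ to the open sets of ℝ
image : {X : Poset c ℓ₁ ℓ₂} (f : ℝ → Poset.Carrier X) → IsContinuousᴿ X f →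
        Measure → SetFunction X
image f f-continuous μ V = measure μ (f ⊢ proj₁ V , open-set (f-continuous V))

------------------------------------------------------------------------
-- Partitions

record Partition : Set₁ where
  field
    first      : ℝ
    rest       : List ℝ
    increasing : Linked _<ᴿ_ (first ∷ rest)

consecutive : ∀ {as} → Linked _<ᴿ_ as → List Interval
consecutive []                      = []
consecutive [-]                     = []
consecutive (_∷_ {a} {b} a<b links) = interval a b (<⇒≤ᴿ {a} {b} a<b) ∷ consecutive links

-- μ_P, with the intervals of 𝐈ℝ viewed as elements of X by means of e
approximation : {X : Poset c ℓ₁ ℓ₂} → (Interval → Poset.Carrier X) →
                Measure → Partition → SetFunction X
approximation e μ P = linearCombination
  (map (λ J → measure μ (] lo J , hi J ] , ]]-borel (lo J) (hi J)) , e J)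
       (consecutive (Partition.increasing P)))

dyadic : ℤ → ℕ → ℚ
dyadic k n = (k ℚ./ (2 ^ n)) ⦃ ℕ.m^n≢0 2 n ⦄

dyadic-mono-< : ∀ {k l} n → k ℤ.< l → dyadic k n ℚ.< dyadic l n
dyadic-mono-< {k} {l} n k<l = go (2 ^ n) ⦃ ℕ.m^n≢0 2 n ⦄
  where
  go : ∀ d .⦃ _ : NonZero d ⦄ → k ℚ./ d ℚ.< l ℚ./ d
  go (suc d) = ℚ.toℚᵘ-cancel-< (ℚᵘ.<-respˡ-≃ (ℚᵘ.≃-sym (ℚ.toℚᵘ-fromℚᵘ (mkℚᵘ k d)))
    (ℚᵘ.<-respʳ-≃ (ℚᵘ.≃-sym (ℚ.toℚᵘ-fromℚᵘ (mkℚᵘ l d)))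
      (*<* (ℤ.*-monoʳ-<-pos (+ suc d) k<l))))

-- The numbers k / 2ⁿ for the integers k from −n 2ⁿ to n 2ⁿ, in increasing order
dyadicPartition : ℕ → Partition
dyadicPartition n = record
  { first      = point 0
  ; rest       = applyUpTo (point ∘ suc) (2 ℕ.* (n ℕ.* 2 ^ n))
  ; increasing = applyUpTo⁺₂ point (suc (2 ℕ.* (n ℕ.* 2 ^ n))) λ k →
      ratᴿ-mono-< {dyadic (+ k ℤ.- + (n ℕ.* 2 ^ n)) n} (dyadic-mono-< n (ℤ.+-monoˡ-< (ℤ.- (+ (n ℕ.* 2 ^ n))) (ℤ.+<+ (ℕ.n<1+n k))))
  }
  where
  point : ℕ → ℝ
  point k = ratᴿ (dyadic (+ k ℤ.- + (n ℕ.* 2 ^ n)) n)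

{-# OPTIONS --safe #-}

-- Let V be Scott-open and let Uₙ be the union of those dyadic cells ]a , b] of
-- level n with [a , b] ∈ V.  The cells are disjoint, so the value at V of the
-- nth approximation is μ(Uₙ).  Halving a cell keeps it in V, so the Uₙ increase;
-- their union is ι⁻¹(V), because ι x ∈ V forces some rational interval around x
-- into V.  Continuity of μ from below thus gives μ(ι⁻¹(V)) = sup μ(Uₙ).  That the
-- image is a continuous valuation is then inherited from the approximations.
-- As coefficients may be infinite, an approximation is shown to be minimal by
-- truncating them.

module Submission where

open import Defs
open import Axiom.ExcludedMiddle using (ExcludedMiddle)
open import Data.Empty using (⊥-elim)
open import Data.Integer.Base as ℤ using (ℤ; +_; -[1+_])
import Data.Integer.Properties as ℤ
import Data.Integer.Solver as ℤ-Solver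
open import Data.List.Base using (List; []; _∷_; map)
open import Data.List.Properties using (map-id)
open import Data.List.Relation.Unary.All as All using (All; []; _∷_)
open import Data.List.Relation.Unary.AllPairs using (AllPairs; []; _∷_)
open import Data.List.Relation.Unary.Linked using (Linked; []; [-]; _∷_)
open import Data.List.Relation.Unary.Linked.Properties using (applyUpTo⁺₁)
open import Data.Nat.Base as ℕ using (ℕ; zero; suc; _≤_; NonZero; _^_)
import Data.Nat.Properties as ℕ
import Data.Nat.Solver as ℕ-Solver
open import Data.Product.Base using (Σ-syntax; ∃; ∃₂; _×_; _,_; proj₁; proj₂; map₁)
open import Data.Rational.Base as ℚ using (ℚ; 0ℚ; mkℚ; toℚᵘ; fromℚᵘ; ↥_; ↧ₙ_)
import Data.Rational.Properties as ℚ
import Data.Rational.Solver as ℚ-Solver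
open import Data.Rational.Unnormalised.Base as ℚᵘ using (mkℚᵘ; *≡*; *≤*)
import Data.Rational.Unnormalised.Properties as ℚᵘ
open import Data.Sum.Base using (_⊎_; inj₁; inj₂)
open import Function.Base using (id; _∘_)
open import Function.Bundles using (Equivalence; mk⇔)
open import Level using (Level; 0ℓ; Lift; lift) renaming (suc to lsuc)
open import Relation.Binary.Bundles using (Poset)
open import Relation.Binary.Construct.Add.Infimum.NonStrict using ([_])
open import Relation.Binary.Definitions using (tri<; tri≈; tri>)
open import Relation.Binary.PropositionalEquality.Core
  using (_≡_; _≢_; refl; sym; trans; cong; cong₂; subst; subst₂)
open import Relation.Binary.PropositionalEquality.Properties using (module ≡-Reasoning)
open import Relation.Nullary.Construct.Add.Infimum using (⊥₋; [_])
open import Relation.Nullary.Decidable.Core using (Dec; yes; no; True; toWitness; fromWitness)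
open import Relation.Unary
  using (Pred; _∈_; _∉_; _⊢_; _⊆_; _⊆′_; _≐_; _∪_; _∩_; ∁; ⋃; ⋂; ∅) renaming (_⊥_ to Disjoint)

open [0,∞] using (Below; rounded)

-- A measure is continuous only along countable chains, whereas a valuation must respect arbitrary
-- directed suprema of open sets. Linear combinations of Dirac valuations do, since only finitely
-- many points matter; exchanging the countable supremum with the directed one then gives the image
-- its Scott continuity. Values may be ∞, so nothing is ever subtracted: increasing unions are cut
-- into disjoint differences and only additivity is applied. Openness of the preimage under ι is too
-- weak to catch a cell, since it speaks of points. Inaccessibility of V yields a whole rational
-- interval in V, and by upward closure every cell inside that interval. The cells of level n cover
-- only ]-n , n] and have width 1/2ⁿ, so n must be large for two reasons: to reach the point and to
-- make its cell small. Excluded middle compares reals with grid points and decides which cells are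
-- selected; without such decisions the union of the selected cells is not visibly Borel.

private
  variable
    i c ℓ₁ ℓ₂ : Level

-- Arithmetic in [0,∞]

below-downward : ∀ r {p q} → p ℚ.< q → q ∈ Below r → p ∈ Below r
below-downward r p<q q∈r = Equivalence.from (rounded r) (_ , p<q , q∈r)

below-round : ∀ r {q} → q ∈ Below r → ∃ λ p → q ℚ.< p × p ∈ Below r
below-round r = Equivalence.to (rounded r)

0∞-least : ∀ r → 0∞ ≤∞ r
0∞-least r _ = [0,∞].negative r

≈∞-sym : ∀ r s → r ≈∞ s → s ≈∞ r
≈∞-sym r s (r≤s , s≤r) = s≤r , r≤s

≈∞-trans : ∀ r s t → r ≈∞ s → s ≈∞ t → r ≈∞ t
≈∞-trans r s t (r≤s , s≤r) (s≤t , t≤s) =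
  (λ q → s≤t q ∘ r≤s q) , (λ q → s≤r q ∘ t≤s q)

+∞-mono : ∀ r r′ s s′ → r ≤∞ r′ → s ≤∞ s′ → r +∞ s ≤∞ r′ +∞ s′
+∞-mono r r′ s s′ r≤r′ s≤s′ _ (a , b , a∈r , b∈s , q<a+b) =
  a , b , r≤r′ a a∈r , s≤s′ b b∈s , q<a+b

+∞-cong : ∀ r r′ s s′ → r ≈∞ r′ → s ≈∞ s′ → r +∞ s ≈∞ r′ +∞ s′
+∞-cong r r′ s s′ (r≤r′ , r′≤r) (s≤s′ , s′≤s) =
  +∞-mono r r′ s s′ r≤r′ s≤s′ , +∞-mono r′ r s′ s r′≤r s′≤s

+∞-comm-≤ : ∀ r s → r +∞ s ≤∞ s +∞ r
+∞-comm-≤ r s q (a , b , a∈r , b∈s , q<a+b) =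
  b , a , b∈s , a∈r , subst (q ℚ.<_) (ℚ.+-comm a b) q<a+b

+∞-comm : ∀ r s → r +∞ s ≈∞ s +∞ r
+∞-comm r s = +∞-comm-≤ r s , +∞-comm-≤ s r

-- Roundedness supplies `p` above `q` inside `r`; the slack `p - q` absorbs a negative summand, and
-- negative rationals lie below every `s`.
x≤x+∞y : ∀ r s → r ≤∞ r +∞ s
x≤x+∞y r s q q∈r =
  let p , q<p , p∈r = below-round r q∈r
      q-p<0 = subst (q ℚ.- p ℚ.<_) (ℚ.+-inverseʳ p) (ℚ.+-monoˡ-< (ℚ.- p) q<p)
      b , q-p<b , b<0 = ℚ.<-dense q-p<0
  in p , b , p∈r , [0,∞].negative s b<0 ,
     subst (ℚ._< p ℚ.+ b) (cancel p q) (ℚ.+-monoʳ-< p q-p<b)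
  where
  cancel : ∀ p q → p ℚ.+ (q ℚ.- p) ≡ q
  cancel = solve 2 (λ p q → p :+ (q :- p) := q) refl
    where open ℚ-Solver.+-*-Solver

y≤x+∞y : ∀ r s → s ≤∞ r +∞ s
y≤x+∞y r s q = +∞-comm-≤ s r q ∘ x≤x+∞y s r q

+∞-identityʳ : ∀ r → r +∞ 0∞ ≈∞ r
+∞-identityʳ r = upper , x≤x+∞y r 0∞
  where
  upper : r +∞ 0∞ ≤∞ r
  upper q (a , b , a∈r , b<0 , q<a+b) = below-downward r
    (ℚ.<-trans q<a+b (subst (a ℚ.+ b ℚ.<_) (ℚ.+-identityʳ a) (ℚ.+-monoʳ-< a b<0))) a∈r

+∞-identityˡ : ∀ r → 0∞ +∞ r ≈∞ r
+∞-identityˡ r =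
  ≈∞-trans (0∞ +∞ r) (r +∞ 0∞) r (+∞-comm 0∞ r) (+∞-identityʳ r)

+∞-interchange-≤ : ∀ r s t u → (r +∞ s) +∞ (t +∞ u) ≤∞ (r +∞ t) +∞ (s +∞ u)
+∞-interchange-≤ r s t u q
  (x , y , (a , b , a∈r , b∈s , x<a+b) , (c , d , c∈t , d∈u , y<c+d) , q<x+y) =
  -- Membership in a sum asks for a strict inequality, so `a` and `b` are first raised within their
  -- cuts.
  let a′ , a<a′ , a′∈r = below-round r a∈r
      b′ , b<b′ , b′∈s = below-round s b∈s
  in a ℚ.+ c , b ℚ.+ d
   , (a′ , c , a′∈r , c∈t , ℚ.+-monoˡ-< c a<a′)
   , (b′ , d , b′∈s , d∈u , ℚ.+-monoˡ-< d b<b′)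
   , ℚ.<-trans q<x+y (subst (x ℚ.+ y ℚ.<_) (swap a b c d) (ℚ.+-mono-< x<a+b y<c+d))
  where
  swap : ∀ a b c d → (a ℚ.+ b) ℚ.+ (c ℚ.+ d) ≡ (a ℚ.+ c) ℚ.+ (b ℚ.+ d)
  swap = solve 4 (λ a b c d → (a :+ b) :+ (c :+ d) := (a :+ c) :+ (b :+ d)) refl
    where open ℚ-Solver.+-*-Solver

+∞-interchange : ∀ r s t u → (r +∞ s) +∞ (t +∞ u) ≈∞ (r +∞ t) +∞ (s +∞ u)
+∞-interchange r s t u = +∞-interchange-≤ r s t u , +∞-interchange-≤ r t s u

sup∞ : (ℕ → [0,∞]) → [0,∞]
sup∞ a = record
  { Below    = λ q → ∃ λ n → q ∈ Below (a n)
  ; negative = λ q<0 → 0 , [0,∞].negative (a 0) q<0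
  ; rounded  = mk⇔
      (λ (n , q∈) → let p , q<p , p∈ = below-round (a n) q∈ in p , q<p , n , p∈)
      (λ (_ , q<p , n , p∈) → n , below-downward (a n) q<p p∈)
  }

-- The union of the cuts is itself a cut bounding the family. Testing leastness against it turns the
-- universal property into membership at a finite stage.
lub-below : ∀ a s → IsLub [0,∞]-poset a s → ∀ {q} → q ∈ Below s → ∃ λ n → q ∈ Below (a n)
lub-below a s lub {q} = IsLub.least lub {sup∞ a} (λ n _ q∈ → n , q∈) q

below-lub : ∀ {I : Set i} (a : I → [0,∞]) s → (∀ k → a k ≤∞ s) →
            (∀ {q} → q ∈ Below s → ∃ λ k → q ∈ Below (a k)) → IsLub [0,∞]-poset a s
below-lub a s upper approx = record
  { upper = upper
  ; least = λ a≤t q q∈s → let n , q∈a = approx q∈s in a≤t n q q∈a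
  }

-- Linear combinations of Dirac valuations

module _ {X : Poset c ℓ₁ ℓ₂} where
  open Poset X using (Carrier)

  ·δ-∉ : ∀ r {x : Carrier} (V : ScottOpen X) → x ∉ proj₁ V → r ·∞ δ {X = X} x V ≈∞ 0∞
  ·δ-∉ r {x} V x∉V = upper , 0∞-least (r ·∞ δ {X = X} x V)
    where
    upper : r ·∞ δ {X = X} x V ≤∞ 0∞
    upper q (inj₁ q<0) = q<0
    upper q (inj₂ (a , b , _ , (0≤b , inj₁ b<0) , _)) =
      ⊥-elim (ℚ.<-irrefl refl (ℚ.<-≤-trans b<0 0≤b))
    upper q (inj₂ (a , b , _ , (_ , inj₂ (_ , x∈V)) , _)) = ⊥-elim (x∉V x∈V)

  ·δ-∈ : ∀ r {x : Carrier} (V : ScottOpen X) → x ∈ proj₁ V → r ·∞ δ {X = X} x V ≈∞ r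
  ·δ-∈ r {x} V x∈V = upper , lower
    where
    upper : r ·∞ δ {X = X} x V ≤∞ r
    upper q (inj₁ q<0) = [0,∞].negative r q<0
    upper q (inj₂ (a , b , _ , (0≤b , inj₁ b<0) , _)) =
      ⊥-elim (ℚ.<-irrefl refl (ℚ.<-≤-trans b<0 0≤b))
    upper q (inj₂ (a , b , (0≤a , a∈r) , (_ , inj₂ (b<1 , _)) , q<ab)) = below-downward r q<a a∈r
      where
      q<a : q ℚ.< a
      q<a = ℚ.<-≤-trans q<ab (subst (a ℚ.* b ℚ.≤_) (ℚ.*-identityʳ a)
        (ℚ.*-monoˡ-≤-nonNeg a ⦃ ℚ.nonNegative 0≤a ⦄ (ℚ.<⇒≤ b<1)))
    lower : r ≤∞ r ·∞ δ {X = X} x V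
    lower q q∈r with q ℚ.<? 0ℚ
    ... | yes q<0 = inj₁ q<0
    ... | no  q≮0 =
      -- The cut of the Dirac value excludes 1, so the second factor is `t / a` with `q < t < a`: it
      -- stays below 1 and the product is `t`.
      let a , q<a , a∈r = below-round r q∈r
          t , q<t , t<a = ℚ.<-dense q<a
          0≤q = ℚ.≮⇒≥ q≮0
          0<t = ℚ.≤-<-trans 0≤q q<t
          0<a = ℚ.<-trans 0<t t<a
          pos = ℚ.positive 0<a
          b = t ℚ.* (ℚ.1/ a) ⦃ ℚ.pos⇒nonZero a ⦃ pos ⦄ ⦄
          b·a≡t = trans (ℚ.*-assoc t _ a)
            (trans (cong (t ℚ.*_) (ℚ.*-inverseˡ a ⦃ ℚ.pos⇒nonZero a ⦃ pos ⦄ ⦄))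
                   (ℚ.*-identityʳ t))
          0≤b = ℚ.*-cancelʳ-≤-pos a ⦃ pos ⦄
            (subst₂ ℚ._≤_ (sym (ℚ.*-zeroˡ a)) (sym b·a≡t) (ℚ.<⇒≤ 0<t))
          b<1 = ℚ.*-cancelʳ-<-nonNeg a ⦃ ℚ.nonNegative (ℚ.<⇒≤ 0<a) ⦄
            (subst₂ ℚ._<_ (sym b·a≡t) (sym (ℚ.*-identityˡ a)) t<a)
      in inj₂ (a , b , (ℚ.<⇒≤ 0<a , a∈r) , (0≤b , inj₂ (b<1 , x∈V)) ,
               subst (q ℚ.<_) (trans (sym b·a≡t) (ℚ.*-comm b a)) q<t)

  ·δ-mono : ∀ r (x : Carrier) (V W : ScottOpen X) → (x ∈ proj₁ V → x ∈ proj₁ W) →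
            r ·∞ δ {X = X} x V ≤∞ r ·∞ δ {X = X} x W
  ·δ-mono r x V W V⇒W q (inj₁ q<0) = inj₁ q<0
  ·δ-mono r x V W V⇒W q (inj₂ (a , b , a∈r , (0≤b , inj₁ b<0) , q<ab)) =
    inj₂ (a , b , a∈r , (0≤b , inj₁ b<0) , q<ab)
  ·δ-mono r x V W V⇒W q (inj₂ (a , b , a∈r , (0≤b , inj₂ (b<1 , x∈V)) , q<ab)) =
    inj₂ (a , b , a∈r , (0≤b , inj₂ (b<1 , V⇒W x∈V)) , q<ab)

  ·δ-cong : ∀ r (x : Carrier) (V W : ScottOpen X) → (x ∈ proj₁ V → x ∈ proj₁ W) →
            (x ∈ proj₁ W → x ∈ proj₁ V) → r ·∞ δ {X = X} x V ≈∞ r ·∞ δ {X = X} x W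
  ·δ-cong r x V W V⇒W W⇒V = ·δ-mono r x V W V⇒W , ·δ-mono r x W V W⇒V

  linearCombination-mono : ∀ rxs (V W : ScottOpen X) → proj₁ V ⊆′ proj₁ W →
                           linearCombination {X = X} rxs V ≤∞ linearCombination {X = X} rxs W
  linearCombination-mono [] V W V⊆W _ = id
  linearCombination-mono ((r , x) ∷ rxs) V W V⊆W =
    +∞-mono (r ·∞ δ {X = X} x V) (r ·∞ δ {X = X} x W)
      (linearCombination {X = X} rxs V) (linearCombination {X = X} rxs W)
      (·δ-mono r x V W (V⊆W x)) (linearCombination-mono rxs V W V⊆W)

  linearCombination-strict : ∀ rxs → linearCombination {X = X} rxs ∅ˢ ≈∞ 0∞
  linearCombination-strict [] = (λ _ → id) , (λ _ → id)
  linearCombination-strict ((r , x) ∷ rxs) =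
    ≈∞-trans (r ·∞ δ {X = X} x ∅ˢ +∞ linearCombination {X = X} rxs ∅ˢ) (0∞ +∞ 0∞) 0∞
      (+∞-cong (r ·∞ δ {X = X} x ∅ˢ) 0∞ (linearCombination {X = X} rxs ∅ˢ) 0∞
        (·δ-∉ r {x} ∅ˢ (λ ())) (linearCombination-strict rxs))
      (+∞-identityʳ 0∞)

-- Suprema of chains of continuous valuations

module _ {X : Poset c ℓ₁ ℓ₂} where

  -- Suprema commute, so the one over `n` exchanges with the directed one over open sets. Modularity
  -- survives because, along a chain, what holds at stages `m` and `n` holds together at `m ⊔ n`.
  supremum-isContinuousValuation :
    (ν : ℕ → SetFunction X) (ξ : SetFunction X) → (∀ n → IsContinuousValuation X (ν n)) →
    (∀ {m n} → m ≤ n → ∀ V → ν m V ≤∞ ν n V) →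
    (∀ V → IsLub [0,∞]-poset (λ n → ν n V) (ξ V)) → IsContinuousValuation X ξ
  supremum-isContinuousValuation ν ξ val chain sup = record
    { continuous = record
      { mono         = λ {V} {W} → mono V W
      ; preservesLub = λ {_} {g} {s} dir lub → record
        { upper = λ k → mono (g k) s (IsLub.upper lub k)
        ; least = λ {t} ξg≤t → IsLub.least (sup s) {t} λ n →
            IsLub.least (preservesLub (continuous (val n)) dir lub) {t} λ k q q∈ →
              ξg≤t k q (IsLub.upper (sup (g k)) n q q∈)
        }
      }
    ; strict     =
        IsLub.least (sup ∅ˢ) {0∞} (λ n → proj₁ (strict (val n))) , 0∞-least (ξ ∅ˢ)
    ; modular    = λ V W → modular-≤ V W , modular-≥ V W
    }
    where
    open IsContinuousValuation
    open IsScottContinuous using (preservesLub)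

    mono : ∀ V W → proj₁ V ⊆′ proj₁ W → ξ V ≤∞ ξ W
    mono V W V⊆W = IsLub.least (sup V) {ξ W} λ n q q∈ →
      IsLub.upper (sup W) n q
        (IsScottContinuous.mono (continuous (val n)) {V} {W} V⊆W q q∈)

    ν+ν : ∀ V W {q} → q ∈ Below (ξ V +∞ ξ W) → ∃ λ n → q ∈ Below (ν n V +∞ ν n W)
    ν+ν V W (a , b , a∈ , b∈ , q<a+b) =
      let m , a∈m = lub-below _ _ (sup V) a∈
          n , b∈n = lub-below _ _ (sup W) b∈
      in m ℕ.⊔ n , a , b , chain (ℕ.m≤m⊔n m n) V a a∈m , chain (ℕ.m≤n⊔m m n) W b b∈n , q<a+b

    ν+ν≤ξ+ξ : ∀ n V W → ν n V +∞ ν n W ≤∞ ξ V +∞ ξ W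
    ν+ν≤ξ+ξ n V W = +∞-mono (ν n V) (ξ V) (ν n W) (ξ W)
      (IsLub.upper (sup V) n) (IsLub.upper (sup W) n)

    modular-≤ : ∀ V W → ξ (V ∪ˢ W) +∞ ξ (V ∩ˢ W) ≤∞ ξ V +∞ ξ W
    modular-≤ V W q q∈ =
      let n , q∈n = ν+ν (V ∪ˢ W) (V ∩ˢ W) q∈
      in ν+ν≤ξ+ξ n V W q (proj₁ (modular (val n) V W) q q∈n)

    modular-≥ : ∀ V W → ξ V +∞ ξ W ≤∞ ξ (V ∪ˢ W) +∞ ξ (V ∩ˢ W)
    modular-≥ V W q q∈ =
      let n , q∈n = ν+ν V W q∈
      in ν+ν≤ξ+ξ n (V ∪ˢ W) (V ∩ˢ W) q (proj₂ (modular (val n) V W) q q∈n)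

-- Excluded middle brings the union of a large family of predicates down to
-- level 0.

module _ (em : ∀ {ℓ} → ExcludedMiddle ℓ) where

  module _ {X : Poset c ℓ₁ ℓ₂} where
    open Poset X using (Carrier)

    -- The union is Scott-open and bounds the family, so leastness of `s` applies to it. Wrapping
    -- the decision in `True` keeps the union at level 0 whatever the level of `I`.
    lub⊆union : ∀ {I : Set i} (g : I → ScottOpen X) s → IsLub (ScottOpen-poset X) g s →
                ∀ {x} → x ∈ proj₁ s → ∃ λ k → x ∈ proj₁ (g k)
    lub⊆union g s lub {x} x∈s = toWitness
      (IsLub.least lub {⋃g} (λ k _ y∈gk → fromWitness (k , y∈gk)) x x∈s)
      where
      open IsScottOpen
      ⋃g : ScottOpen X
      ⋃g = (λ y → True (em {P = ∃ λ k → y ∈ proj₁ (g k)})) , record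
        { upward       = λ y≤z y∈ →
            let k , y∈gk = toWitness y∈
            in fromWitness (k , upward (proj₂ (g k)) y≤z y∈gk)
        ; inaccessible = λ dir lub y∈ →
            let k , y∈gk = toWitness y∈
                l , l∈gk = inaccessible (proj₂ (g k)) dir lub y∈gk
            in l , fromWitness (k , l∈gk)
        }

    -- Each of the finitely many points that lie in `s` already lies in some `g k`; directedness
    -- merges these indices into one.
    linearCombination-inaccessible :
      ∀ {I : Set i} (g : I → ScottOpen X) s → IsDirected (ScottOpen-poset X) g →
      IsLub (ScottOpen-poset X) g s → ∀ rxs {q} → q ∈ Below (linearCombination {X = X} rxs s) →
      ∃ λ k → q ∈ Below (linearCombination {X = X} rxs (g k))
    linearCombination-inaccessible g s dir lub [] q<0 = IsDirected.inhabitant dir , q<0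
    linearCombination-inaccessible g s dir lub ((r , x) ∷ rxs) {q} (a , b , a∈ , b∈ , q<a+b) =
      let k , a∈k = term a∈
          l , b∈l = linearCombination-inaccessible g s dir lub rxs b∈
          m , k≤m , l≤m = IsDirected.bound dir k l
      in m , a , b , ·δ-mono r x (g k) (g m) (k≤m x) a a∈k
           , linearCombination-mono rxs (g l) (g m) l≤m b b∈l , q<a+b
      where
      term : ∀ {a} → a ∈ Below (r ·∞ δ {X = X} x s) → ∃ λ k → a ∈ Below (r ·∞ δ {X = X} x (g k))
      term (inj₁ a<0) = IsDirected.inhabitant dir , inj₁ a<0
      term (inj₂ (u , v , u∈ , (0≤v , inj₁ v<0) , a<uv)) =
        IsDirected.inhabitant dir , inj₂ (u , v , u∈ , (0≤v , inj₁ v<0) , a<uv)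
      term (inj₂ (u , v , u∈ , (0≤v , inj₂ (v<1 , x∈s)) , a<uv)) =
        let k , x∈gk = lub⊆union g s lub x∈s
        in k , inj₂ (u , v , u∈ , (0≤v , inj₂ (v<1 , x∈gk)) , a<uv)

    -- As seen from the point `x`, the pair of union and intersection is the pair `V`, `W` if
    -- `x ∈ V`, and the pair `W`, `V` otherwise.
    ·δ-modular : ∀ r (x : Carrier) (V W : ScottOpen X) →
                 r ·∞ δ {X = X} x (V ∪ˢ W) +∞ r ·∞ δ {X = X} x (V ∩ˢ W) ≈∞
                 r ·∞ δ {X = X} x V +∞ r ·∞ δ {X = X} x W
    ·δ-modular r x V W with em {P = x ∈ proj₁ V}
    ... | yes x∈V = +∞-cong (rδ (V ∪ˢ W)) (rδ V) (rδ (V ∩ˢ W)) (rδ W)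
      (·δ-cong r x (V ∪ˢ W) V (λ _ → x∈V) inj₁) (·δ-cong r x (V ∩ˢ W) W proj₂ (x∈V ,_))
      where rδ = λ U → r ·∞ δ {X = X} x U
    ... | no  x∉V = ≈∞-trans (rδ (V ∪ˢ W) +∞ rδ (V ∩ˢ W)) (rδ W +∞ rδ V) (rδ V +∞ rδ W)
      (+∞-cong (rδ (V ∪ˢ W)) (rδ W) (rδ (V ∩ˢ W)) (rδ V)
        (·δ-cong r x (V ∪ˢ W) W (λ { (inj₁ x∈V) → ⊥-elim (x∉V x∈V) ; (inj₂ x∈W) → x∈W }) inj₂)
        (·δ-cong r x (V ∩ˢ W) V proj₁ (⊥-elim ∘ x∉V)))
      (+∞-comm (rδ W) (rδ V))
      where rδ = λ U → r ·∞ δ {X = X} x U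

    linearCombination-modular : ∀ rxs (V W : ScottOpen X) →
      linearCombination {X = X} rxs (V ∪ˢ W) +∞ linearCombination {X = X} rxs (V ∩ˢ W) ≈∞
      linearCombination {X = X} rxs V +∞ linearCombination {X = X} rxs W
    linearCombination-modular [] V W = (λ _ → id) , (λ _ → id)
    linearCombination-modular ((r , x) ∷ rxs) V W =
      ≈∞-trans ((t (V ∪ˢ W) +∞ l (V ∪ˢ W)) +∞ (t (V ∩ˢ W) +∞ l (V ∩ˢ W)))
               ((t (V ∪ˢ W) +∞ t (V ∩ˢ W)) +∞ (l (V ∪ˢ W) +∞ l (V ∩ˢ W)))
               ((t V +∞ l V) +∞ (t W +∞ l W))
        (+∞-interchange (t (V ∪ˢ W)) (l (V ∪ˢ W)) (t (V ∩ˢ W)) (l (V ∩ˢ W)))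
        (≈∞-trans ((t (V ∪ˢ W) +∞ t (V ∩ˢ W)) +∞ (l (V ∪ˢ W) +∞ l (V ∩ˢ W)))
                  ((t V +∞ t W) +∞ (l V +∞ l W))
                  ((t V +∞ l V) +∞ (t W +∞ l W))
          (+∞-cong (t (V ∪ˢ W) +∞ t (V ∩ˢ W)) (t V +∞ t W)
                   (l (V ∪ˢ W) +∞ l (V ∩ˢ W)) (l V +∞ l W)
            (·δ-modular r x V W) (linearCombination-modular rxs V W))
          (+∞-interchange (t V) (t W) (l V) (l W)))
      where
      t l : SetFunction X
      t U = r ·∞ δ {X = X} x U
      l U = linearCombination {X = X} rxs U

    linearCombination-isContinuousValuation :
      ∀ rxs → IsContinuousValuation X (linearCombination {X = X} rxs)
    linearCombination-isContinuousValuation rxs = record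
      { continuous = record
        { mono         = λ {V} {W} → linearCombination-mono rxs V W
        ; preservesLub = λ {_} {g} {s} dir lub → below-lub _ _
            (λ k → linearCombination-mono rxs (g k) s (IsLub.upper lub k))
            (linearCombination-inaccessible g s dir lub rxs)
        }
      ; strict     = linearCombination-strict {X = X} rxs
      ; modular    = linearCombination-modular rxs
      }

-- Finite additivity of measures and continuity from below

open Measure

-- Padding with ∅ derives binary unions and finite additivity from the countable clauses.
firstTwo : BorelSet → BorelSet → ℕ → BorelSet
firstTwo A B zero          = A
firstTwo A B (suc zero)    = B
firstTwo A B (suc (suc _)) = ∅ᴮ

⋃-firstTwo : ∀ A B → ⋃ ℕ (proj₁ ∘ firstTwo A B) ≐ proj₁ A ∪ proj₁ B
⋃-firstTwo A B = to , from
  where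
  to : ⋃ ℕ (proj₁ ∘ firstTwo A B) ⊆ proj₁ A ∪ proj₁ B
  to (zero , x∈A)     = inj₁ x∈A
  to (suc zero , x∈B) = inj₂ x∈B
  from : proj₁ A ∪ proj₁ B ⊆ ⋃ ℕ (proj₁ ∘ firstTwo A B)
  from (inj₁ x∈A) = 0 , x∈A
  from (inj₂ x∈B) = 1 , x∈B

_∪ᴮ_ _∖ᴮ_ : BorelSet → BorelSet → BorelSet
A ∪ᴮ B = proj₁ A ∪ proj₁ B , resp (⋃-firstTwo A B) (union (proj₂ ∘ firstTwo A B))
A ∖ᴮ B = proj₁ A ∩ ∁ (proj₁ B) , resp (to , from) (intersection {A = conjunct} conjunct-borel)
  where
  conjunct : ℕ → Pred ℝ 0ℓ
  conjunct zero    = proj₁ A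
  conjunct (suc _) = ∁ (proj₁ B)
  conjunct-borel : ∀ n → IsBorel (conjunct n)
  conjunct-borel zero    = proj₂ A
  conjunct-borel (suc _) = complement (proj₂ B)
  to : ∀ {x} → x ∈ ⋂ ℕ conjunct → x ∈ proj₁ A ∩ ∁ (proj₁ B)
  to h = h 0 , h 1
  from : ∀ {x} → x ∈ proj₁ A ∩ ∁ (proj₁ B) → x ∈ ⋂ ℕ conjunct
  from (x∈A , x∉B) zero    = x∈A
  from (x∈A , x∉B) (suc _) = x∉B

module _ (μ : Measure) where

  -- The partial sums of the padded sequence reach the sum of both measures at index 2 and stay
  -- there, the later terms being 0.
  measure-∪ : ∀ A B → Disjoint (proj₁ A) (proj₁ B) →
              measure μ (A ∪ᴮ B) ≈∞ measure μ A +∞ measure μ B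
  measure-∪ A B A∩B≡∅ =
    ≈∞-trans (measure μ (A ∪ᴮ B)) (measure μ (⋃ᴮ (firstTwo A B)))
             (measure μ A +∞ measure μ B)
      (≈∞-sym (measure μ (⋃ᴮ (firstTwo A B))) (measure μ (A ∪ᴮ B))
        (measure-cong μ {⋃ᴮ (firstTwo A B)} {A ∪ᴮ B} (⋃-firstTwo A B)))
      (IsLub.least lub {measure μ A +∞ measure μ B} bound ,
       λ q q∈ → IsLub.upper lub 2 q
         (+∞-mono (measure μ A) (0∞ +∞ measure μ A) (measure μ B) (measure μ B)
           (y≤x+∞y 0∞ (measure μ A)) (λ _ → id) q q∈))
    where
    disjoint-terms : ∀ m n → m ≢ n →
                     Disjoint (proj₁ (firstTwo A B m)) (proj₁ (firstTwo A B n))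
    disjoint-terms zero       zero       m≢n _           = m≢n refl
    disjoint-terms zero       (suc zero) _   (x∈A , x∈B) = A∩B≡∅ (x∈A , x∈B)
    disjoint-terms (suc zero) zero       _   (x∈B , x∈A) = A∩B≡∅ (x∈A , x∈B)
    disjoint-terms (suc zero) (suc zero) m≢n _           = m≢n refl

    lub : IsLub [0,∞]-poset (partialSum (measure μ ∘ firstTwo A B))
                            (measure μ (⋃ᴮ (firstTwo A B)))
    lub = measure-⋃ μ (firstTwo A B) disjoint-terms

    bound : ∀ n → partialSum (measure μ ∘ firstTwo A B) n ≤∞ measure μ A +∞ measure μ B
    bound zero       = 0∞-least (measure μ A +∞ measure μ B)
    bound (suc zero) q q∈ =
      x≤x+∞y (measure μ A) (measure μ B) q (proj₁ (+∞-identityˡ (measure μ A)) q q∈)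
    bound (suc (suc zero)) =
      +∞-mono (0∞ +∞ measure μ A) (measure μ A) (measure μ B) (measure μ B)
        (proj₁ (+∞-identityˡ (measure μ A))) (λ _ → id)
    bound (suc (suc (suc n))) q q∈ =
      proj₁ (+∞-identityʳ (measure μ A +∞ measure μ B)) q
        (+∞-mono (partialSum (measure μ ∘ firstTwo A B) (suc (suc n)))
                 (measure μ A +∞ measure μ B) (measure μ ∅ᴮ) 0∞
          (bound (suc (suc n))) (proj₁ (measure-∅ μ)) q q∈)

  module _ (em : ∀ {ℓ} → ExcludedMiddle ℓ) where

    ≐-split : ∀ A B → proj₁ A ⊆ proj₁ B → proj₁ B ≐ proj₁ (A ∪ᴮ (B ∖ᴮ A))
    ≐-split A B A⊆B = to , λ { (inj₁ x∈A) → A⊆B x∈A ; (inj₂ (x∈B , _)) → x∈B }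
      where
      to : ∀ {x} → x ∈ proj₁ B → x ∈ proj₁ (A ∪ᴮ (B ∖ᴮ A))
      to {x} x∈B with em {P = x ∈ proj₁ A}
      ... | yes x∈A = inj₁ x∈A
      ... | no  x∉A = inj₂ (x∈B , x∉A)

    measure-split : ∀ A B → proj₁ A ⊆ proj₁ B →
                    measure μ B ≈∞ measure μ A +∞ measure μ (B ∖ᴮ A)
    measure-split A B A⊆B =
      ≈∞-trans (measure μ B) (measure μ (A ∪ᴮ (B ∖ᴮ A)))
               (measure μ A +∞ measure μ (B ∖ᴮ A))
        (measure-cong μ {B} {A ∪ᴮ (B ∖ᴮ A)} (≐-split A B A⊆B))
        (measure-∪ A (B ∖ᴮ A) (λ (x∈A , _ , x∉A) → x∉A x∈A))

    measure-mono : ∀ A B → proj₁ A ⊆ proj₁ B → measure μ A ≤∞ measure μ B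
    measure-mono A B A⊆B q q∈ =
      proj₂ (measure-split A B A⊆B) q (x≤x+∞y (measure μ A) (measure μ (B ∖ᴮ A)) q q∈)

    -- The successive differences `D` are disjoint with the same union, and their partial sums
    -- telescope to the measures of the `A n`.
    measure-⋃-chain : (A : ℕ → BorelSet) → (∀ {m n} → m ≤ n → proj₁ (A m) ⊆ proj₁ (A n)) →
                      IsLub [0,∞]-poset (measure μ ∘ A) (measure μ (⋃ᴮ A))
    measure-⋃-chain A chain = record
      { upper = λ n → measure-mono (A n) (⋃ᴮ A) (n ,_)
      ; least = λ {t} A≤t q q∈ → IsLub.least (measure-⋃ μ D disjoint-D) {t}
          -- The indices are off by one: the empty sum is 0, and the sum with `suc n` terms is the
          -- measure of `A n`.
          (λ { zero    → 0∞-least t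
             ; (suc n) p p∈ → A≤t n p (proj₁ (partialSum-D n) p p∈) })
          q (measure-mono (⋃ᴮ A) (⋃ᴮ D) (λ (n , x∈A) → ⋃A⊆⋃D n x∈A) q q∈)
      }
      where
      D : ℕ → BorelSet
      D zero    = A zero
      D (suc n) = A (suc n) ∖ᴮ A n

      D⊆A : ∀ n → proj₁ (D n) ⊆ proj₁ (A n)
      D⊆A zero    = id
      D⊆A (suc n) = proj₁

      disjoint-< : ∀ {m n} → m ℕ.< n → Disjoint (proj₁ (D m)) (proj₁ (D n))
      disjoint-< {m} {suc n} (ℕ.s≤s m≤n) (x∈Dm , _ , x∉An) = x∉An (chain m≤n (D⊆A m x∈Dm))

      disjoint-D : ∀ m n → m ≢ n → Disjoint (proj₁ (D m)) (proj₁ (D n))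
      disjoint-D m n m≢n with ℕ.<-cmp m n
      ... | tri< m<n _ _ = disjoint-< m<n
      ... | tri≈ _ m≡n _ = ⊥-elim (m≢n m≡n)
      ... | tri> _ _ n<m = λ (x∈Dm , x∈Dn) → disjoint-< n<m (x∈Dn , x∈Dm)

      partialSum-D : ∀ n → partialSum (measure μ ∘ D) (suc n) ≈∞ measure μ (A n)
      partialSum-D zero    = +∞-identityˡ (measure μ (A zero))
      partialSum-D (suc n) =
        ≈∞-trans (partialSum (measure μ ∘ D) (suc (suc n)))
                 (measure μ (A n) +∞ measure μ (D (suc n))) (measure μ (A (suc n)))
          (+∞-cong (partialSum (measure μ ∘ D) (suc n)) (measure μ (A n))
                   (measure μ (D (suc n))) (measure μ (D (suc n)))
            (partialSum-D n) ((λ _ → id) , (λ _ → id)))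
          (≈∞-sym (measure μ (A (suc n))) (measure μ (A n) +∞ measure μ (D (suc n)))
            (measure-split (A n) (A (suc n)) (chain (ℕ.n≤1+n n))))

      -- Descent to the first stage containing the point; there the point lies in the difference.
      ⋃A⊆⋃D : ∀ n {x} → x ∈ proj₁ (A n) → ∃ λ m → x ∈ proj₁ (D m)
      ⋃A⊆⋃D zero    x∈A0 = 0 , x∈A0
      ⋃A⊆⋃D (suc n) {x} x∈A with em {P = x ∈ proj₁ (A n)}
      ... | yes x∈An = ⋃A⊆⋃D n x∈An
      ... | no  x∉An = suc n , x∈A , x∉An

-- Unions of selected cells

open Interval

cell : Interval → Pred ℝ 0ℓ
cell J = ] lo J , hi J ]

cellᴮ : Interval → BorelSet
cellᴮ J = cell J , ]]-borel (lo J) (hi J)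

-- Selection is built into the set instead of filtering the list: an unselected cell contributes the
-- empty set, so the list of cells is the same for every `C`.
part : Pred Interval 0ℓ → Interval → Pred ℝ 0ℓ
part C J x = J ∈ C × x ∈ cell J

covered : Pred Interval 0ℓ → List Interval → Pred ℝ 0ℓ
covered C []       = ∅
covered C (J ∷ Js) = part C J ∪ covered C Js

Separated : List Interval → Set₁
Separated = AllPairs (λ J K → hi J ≤ᴿ lo K)

consecutive-above : ∀ {a as} (l : Linked _<ᴿ_ (a ∷ as)) →
                    All (λ J → a ≤ᴿ lo J) (consecutive l)
consecutive-above [-]             = []
consecutive-above {a} (_∷_ {y = b} a<b l) = ≤ᴿ-refl a ∷
  All.map (λ b≤J q q∈a → b≤J q (<⇒≤ᴿ {a} {b} a<b q q∈a)) (consecutive-above l)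

consecutive-separated : ∀ {as} (l : Linked _<ᴿ_ as) → Separated (consecutive l)
consecutive-separated []        = []
consecutive-separated [-]       = []
consecutive-separated (a<b ∷ l) = consecutive-above l ∷ consecutive-separated l

-- A common point would lie strictly above `lo K` and yet at most at `hi J`. Leaving out left ends
-- is what separates neighbours sharing an endpoint.
cell-disjoint : ∀ {J K} → hi J ≤ᴿ lo K → Disjoint (cell J) (cell K)
cell-disjoint {J} {K} J≤K {x} ((_ , x≤J) , (q , K<q , q<x) , _) =
  disjoint (lo K) (J≤K q (x≤J q q<x) , K<q)
  where open ℝ

covered-disjoint : ∀ C {J Ks} → All (λ K → hi J ≤ᴿ lo K) Ks → Disjoint (cell J) (covered C Ks)
covered-disjoint C {J} (_∷_ {K} J≤K J≤Ks) {x} (x∈J , inj₁ (_ , x∈K)) =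
  cell-disjoint {J} {K} J≤K {x} (x∈J , x∈K)
covered-disjoint C {J} (_ ∷ J≤Ks) (x∈J , inj₂ x∈Ks) =
  covered-disjoint C {J} J≤Ks (x∈J , x∈Ks)

module _ (em : ∀ {ℓ} → ExcludedMiddle ℓ) where

  -- An arbitrary proposition `J ∈ C` enters the set; once it is decided, the set is the cell or
  -- empty.
  partᴮ : Pred Interval 0ℓ → Interval → BorelSet
  partᴮ C J = part C J , borel em
    where
    borel : Dec (J ∈ C) → IsBorel (part C J)
    borel (yes J∈C) = resp ((J∈C ,_) , proj₂) (proj₂ (cellᴮ J))
    borel (no  J∉C) = resp ((λ ()) , ⊥-elim ∘ J∉C ∘ proj₁) (proj₂ ∅ᴮ)

  covered-borel : ∀ C Js → IsBorel (covered C Js)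
  covered-borel C []       = proj₂ ∅ᴮ
  covered-borel C (J ∷ Js) =
    proj₂ (partᴮ C J ∪ᴮ (_ , covered-borel C Js))

  coveredᴮ : Pred Interval 0ℓ → List Interval → BorelSet
  coveredᴮ C Js = covered C Js , covered-borel C Js

  module _ {X : Poset c ℓ₁ ℓ₂} (e : Interval → Poset.Carrier X) (μ : Measure) where

    ·δ-measure : ∀ J (V : ScottOpen X) →
      measure μ (cellᴮ J) ·∞ δ {X = X} (e J) V ≈∞ measure μ (partᴮ (e ⊢ proj₁ V) J)
    ·δ-measure J V = cases em
      where
      r = measure μ (cellᴮ J)
      s = measure μ (partᴮ (e ⊢ proj₁ V) J)
      cases : Dec (e J ∈ proj₁ V) → r ·∞ δ {X = X} (e J) V ≈∞ s
      cases (yes J∈V) = ≈∞-trans (r ·∞ δ {X = X} (e J) V) r s (·δ-∈ r V J∈V)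
        (measure-cong μ {cellᴮ J} {partᴮ (e ⊢ proj₁ V) J} ((J∈V ,_) , proj₂))
      cases (no J∉V) = ≈∞-trans (r ·∞ δ {X = X} (e J) V) 0∞ s (·δ-∉ r V J∉V)
        (≈∞-trans 0∞ (measure μ ∅ᴮ) s (≈∞-sym (measure μ ∅ᴮ) 0∞ (measure-∅ μ))
          (measure-cong μ {∅ᴮ} {partᴮ (e ⊢ proj₁ V) J} ((λ ()) , ⊥-elim ∘ J∉V ∘ proj₁)))

    linearCombination-measure :
      ∀ {Js} → Separated Js → (V : ScottOpen X) →
      linearCombination {X = X} (map (λ J → measure μ (cellᴮ J) , e J) Js) V ≈∞
      measure μ (coveredᴮ (e ⊢ proj₁ V) Js)
    linearCombination-measure []                   V = ≈∞-sym (measure μ ∅ᴮ) 0∞ (measure-∅ μ)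
    linearCombination-measure {J ∷ Js} (J≤Js ∷ Js-sep) V =
      ≈∞-trans (rδ +∞ l) (measure μ P +∞ measure μ U) (measure μ (P ∪ᴮ U))
        (+∞-cong rδ (measure μ P) l (measure μ U)
          (·δ-measure J V) (linearCombination-measure Js-sep V))
        (≈∞-sym (measure μ (P ∪ᴮ U)) (measure μ P +∞ measure μ U)
          (measure-∪ μ P U
            (λ ((_ , x∈J) , x∈Js) → covered-disjoint (e ⊢ proj₁ V) {J} J≤Js (x∈J , x∈Js))))
      where
      P = partᴮ (e ⊢ proj₁ V) J
      U = coveredᴮ (e ⊢ proj₁ V) Js
      rδ = measure μ (cellᴮ J) ·∞ δ {X = X} (e J) V
      l = linearCombination {X = X} (map (λ J → measure μ (cellᴮ J) , e J) Js) V

module _ (C : Pred Interval 0ℓ) {x : ℝ} where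

  -- The sequence `f` and the proof `inc` are arbitrary so that the induction can drop the first
  -- point; `suc N` points bound `N` cells.
  covered-applyUpTo⁻ : ∀ f N (inc : ∀ {k} → suc k ℕ.< suc N → f k <ᴿ f (suc k)) →
    x ∈ covered C (consecutive (applyUpTo⁺₁ f (suc N) inc)) →
    ∃ λ k → Σ[ k<N ∈ k ℕ.< N ]
      interval (f k) (f (suc k)) (<⇒≤ᴿ {f k} {f (suc k)} (inc (ℕ.s<s k<N))) ∈ C ×
      x ∈ ] f k , f (suc k) ]
  covered-applyUpTo⁻ f (suc N) inc (inj₁ (J∈C , x∈J)) = 0 , ℕ.z<s , J∈C , x∈J
  covered-applyUpTo⁻ f (suc N) inc (inj₂ x∈) =
    let k , k<N , J∈C , x∈J = covered-applyUpTo⁻ (f ∘ suc) N (inc ∘ ℕ.s<s) x∈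
    in suc k , ℕ.s<s k<N , J∈C , x∈J

  covered-applyUpTo⁺ : ∀ f N (inc : ∀ {k} → suc k ℕ.< suc N → f k <ᴿ f (suc k)) →
    ∀ {k} (k<N : k ℕ.< N) →
    interval (f k) (f (suc k)) (<⇒≤ᴿ {f k} {f (suc k)} (inc (ℕ.s<s k<N))) ∈ C →
    x ∈ ] f k , f (suc k) ] → x ∈ covered C (consecutive (applyUpTo⁺₁ f (suc N) inc))
  covered-applyUpTo⁺ f (suc N) inc {zero}  ℕ.z<s       J∈C x∈J = inj₁ (J∈C , x∈J)
  covered-applyUpTo⁺ f (suc N) inc {suc k} (ℕ.s<s k<N) J∈C x∈J =
    inj₂ (covered-applyUpTo⁺ (f ∘ suc) N (inc ∘ ℕ.s<s) k<N J∈C x∈J)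


-- Finite truncations of the coefficients

Bound : Set
Bound = ∃ (0ℚ ℚ.≤_)

_⊔ᵇ_ : Bound → Bound → Bound
(p , 0≤p) ⊔ᵇ (q , _) = p ℚ.⊔ q , ℚ.≤-trans 0≤p (ℚ.p≤p⊔q p q)

-- The minimum of `r` and `m`. A negative `m` would violate the clause `negative`, whence the
-- condition in `Bound`.
truncate : Bound → [0,∞] → [0,∞]
truncate (m , 0≤m) r = record
  { Below    = λ q → q ∈ Below r × q ℚ.< m
  ; negative = λ q<0 → [0,∞].negative r q<0 , ℚ.<-≤-trans q<0 0≤m
  ; rounded  = mk⇔
      (λ (q∈r , q<m) →
        let p , q<p , p∈r = below-round r q∈r
            t , q<t , t<m = ℚ.<-dense q<m
        in p ℚ.⊓ t , ⊓-greatest q<p q<t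
         , below-≤ (ℚ.p⊓q≤p p t) p∈r , ℚ.≤-<-trans (ℚ.p⊓q≤q p t) t<m)
      (λ (_ , q<p , p∈r , p<m) → below-downward r q<p p∈r , ℚ.<-trans q<p p<m)
  }
  where
  ⊓-greatest : ∀ {q p t} → q ℚ.< p → q ℚ.< t → q ℚ.< p ℚ.⊓ t
  ⊓-greatest {q} {p} {t} q<p q<t with ℚ.⊓-sel p t
  ... | inj₁ eq = subst (q ℚ.<_) (sym eq) q<p
  ... | inj₂ eq = subst (q ℚ.<_) (sym eq) q<t
  below-≤ : ∀ {p q} → p ℚ.≤ q → q ∈ Below r → p ∈ Below r
  below-≤ p≤q q∈r =
    let t , q<t , t∈r = below-round r q∈r in below-downward r (ℚ.≤-<-trans p≤q q<t) t∈r

truncate-finite : ∀ m r → Finite (truncate m r)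
truncate-finite (m , _) r = m , λ (_ , m<m) → ℚ.<-irrefl refl m<m

truncate-≤ : ∀ m r → truncate m r ≤∞ r
truncate-≤ m r _ = proj₁

truncate-mono : ∀ m n → proj₁ m ℚ.≤ proj₁ n → ∀ r → truncate m r ≤∞ truncate n r
truncate-mono m n m≤n r _ (q∈r , q<m) = q∈r , ℚ.<-≤-trans q<m m≤n

truncate-approx : ∀ r {q} → q ∈ Below r → ∃ λ m → q ∈ Below (truncate m r)
truncate-approx r q∈r =
  let p , q<p , _ = below-round r q∈r
  -- The bound must exceed `q` strictly, as it is not below itself, and must be nonnegative even if
  -- `p` is negative.
  in (p ℚ.⊔ 0ℚ , ℚ.p≤q⊔p p 0ℚ) , q∈r , ℚ.<-≤-trans q<p (ℚ.p≤p⊔q p 0ℚ)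

module _ {X : Poset c ℓ₁ ℓ₂} where
  open Poset X using (Carrier)

  mapCoefficients : ([0,∞] → [0,∞]) → List ([0,∞] × Carrier) → List ([0,∞] × Carrier)
  mapCoefficients f = map (map₁ f)

  ·∞-monoˡ : ∀ r s t → r ≤∞ s → r ·∞ t ≤∞ s ·∞ t
  ·∞-monoˡ r s t r≤s q (inj₁ q<0) = inj₁ q<0
  ·∞-monoˡ r s t r≤s q (inj₂ (a , b , (0≤a , a∈r) , b∈t , q<ab)) =
    inj₂ (a , b , (0≤a , r≤s a a∈r) , b∈t , q<ab)

  mapCoefficients-mono : ∀ {f g} → (∀ r → f r ≤∞ g r) → ∀ rxs V →
    linearCombination {X = X} (mapCoefficients f rxs) V ≤∞
    linearCombination {X = X} (mapCoefficients g rxs) V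
  mapCoefficients-mono f≤g [] V _ = id
  mapCoefficients-mono {f} {g} f≤g ((r , x) ∷ rxs) V =
    +∞-mono (f r ·∞ δ {X = X} x V) (g r ·∞ δ {X = X} x V)
      (linearCombination {X = X} (mapCoefficients f rxs) V)
      (linearCombination {X = X} (mapCoefficients g rxs) V)
      (·∞-monoˡ (f r) (g r) (δ {X = X} x V) (f≤g r)) (mapCoefficients-mono f≤g rxs V)

  truncated : List ([0,∞] × Carrier) → Bound → SetFunction X
  truncated rxs m = linearCombination {X = X} (mapCoefficients (truncate m) rxs)

  truncated-mono : ∀ rxs m n → proj₁ m ℚ.≤ proj₁ n → ∀ V → truncated rxs m V ≤∞ truncated rxs n V
  truncated-mono rxs m n m≤n = mapCoefficients-mono (truncate-mono m n m≤n) rxs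

  truncated-≤ : ∀ rxs m V → truncated rxs m V ≤∞ linearCombination {X = X} rxs V
  truncated-≤ rxs m V = subst (λ sxs → truncated rxs m V ≤∞ linearCombination {X = X} sxs V)
    -- The untruncated combination is read as the one with the identity mapped over its
    -- coefficients, so that monotonicity in the mapped function applies.
    (map-id rxs) (mapCoefficients-mono (truncate-≤ m) rxs V)

  truncated-approx : ∀ rxs V {q} → q ∈ Below (linearCombination {X = X} rxs V) →
                     ∃ λ m → q ∈ Below (truncated rxs m V)
  truncated-approx [] V q<0 = (0ℚ , ℚ.≤-refl) , q<0
  truncated-approx ((r , x) ∷ rxs) V {q} (a , b , a∈ , b∈ , q<a+b) =
    let m , a∈m = term a∈
        n , b∈n = truncated-approx rxs V b∈
    in m ⊔ᵇ n , a , b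
     , ·∞-monoˡ (truncate m r) (truncate (m ⊔ᵇ n) r) (δ {X = X} x V)
         (truncate-mono m (m ⊔ᵇ n) (ℚ.p≤p⊔q (proj₁ m) (proj₁ n)) r) a a∈m
     , truncated-mono rxs n (m ⊔ᵇ n) (ℚ.p≤q⊔p (proj₁ m) (proj₁ n)) V b b∈n
     , q<a+b
    where
    term : ∀ {a} → a ∈ Below (r ·∞ δ {X = X} x V) → ∃ λ m → a ∈ Below (truncate m r ·∞ δ {X = X} x V)
    term (inj₁ a<0) = (0ℚ , ℚ.≤-refl) , inj₁ a<0
    term (inj₂ (u , v , (0≤u , u∈r) , v∈ , a<uv)) =
      let m , u∈m = truncate-approx r u∈r in m , inj₂ (u , v , (0≤u , u∈m) , v∈ , a<uv)

  truncated-finite : ∀ rxs m → All (Finite ∘ proj₁) (mapCoefficients (truncate m) rxs)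
  truncated-finite []              m = []
  truncated-finite ((r , x) ∷ rxs) m = truncate-finite m r ∷ truncated-finite rxs m

module _ {X : Poset c ℓ₁ ℓ₂} where

  pointwise-lub : ∀ {I : Set i} {ν : I → Poset.Carrier (𝐕 X)} {ξ} →
                  (∀ V → IsLub [0,∞]-poset (λ k → proj₁ (ν k) V) (proj₁ ξ V)) → IsLub (𝐕 X) ν ξ
  pointwise-lub {ν = ν} {ξ} lub = record
    { upper = λ k V → IsLub.upper (lub V) k
    ; least = λ {ζ} ν≤ζ V → IsLub.least (lub V) {proj₁ ζ V} (λ k → ν≤ζ k V)
    }

module _ (em : ∀ {ℓ} → ExcludedMiddle ℓ) {X : Poset c ℓ₁ ℓ₂} where
  open Poset X using (Carrier)

  -- A coefficient ∞ is the directed supremum of its finite truncations.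
  linearCombination-isMinimal : ∀ rxs (val : IsContinuousValuation X (linearCombination {X = X} rxs)) →
                                IsMinimal {X = X} (linearCombination {X = X} rxs , val)
  linearCombination-isMinimal rxs val = directedSup
    (λ (lift m) → truncated {X = X} rxs m ,
       linearCombination-isContinuousValuation em (mapCoefficients {X = X} (truncate m) rxs))
    (record
      { inhabitant = lift (0ℚ , ℚ.≤-refl)
      ; bound      = λ (lift m) (lift n) → lift (m ⊔ᵇ n)
          , truncated-mono {X = X} rxs m (m ⊔ᵇ n) (ℚ.p≤p⊔q (proj₁ m) (proj₁ n))
          , truncated-mono {X = X} rxs n (m ⊔ᵇ n) (ℚ.p≤q⊔p (proj₁ m) (proj₁ n))
      })
    (pointwise-lub λ V → below-lub
      (λ (lift m) → truncated {X = X} rxs m V) (linearCombination {X = X} rxs V)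
      (λ (lift m) → truncated-≤ {X = X} rxs m V)
      (λ q∈ → let m , q∈m = truncated-approx {X = X} rxs V q∈ in lift m , q∈m))
    (λ (lift m) → simple (mapCoefficients {X = X} (truncate m) rxs) (truncated-finite {X = X} rxs m)
      (λ V → (λ _ → id) , (λ _ → id)))

-- Dyadic rationals

/-mono-≤ : ∀ i j m n .⦃ _ : NonZero m ⦄ .⦃ _ : NonZero n ⦄ →
           i ℤ.* + n ℤ.≤ j ℤ.* + m → i ℚ./ m ℚ.≤ j ℚ./ n
/-mono-≤ i j (suc m) (suc n) in≤jm = ℚ.toℚᵘ-cancel-≤
  (ℚᵘ.≤-respˡ-≃ (ℚᵘ.≃-sym (ℚ.toℚᵘ-fromℚᵘ (mkℚᵘ i m)))
    (ℚᵘ.≤-respʳ-≃ (ℚᵘ.≃-sym (ℚ.toℚᵘ-fromℚᵘ (mkℚᵘ j n))) (*≤* in≤jm)))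

/-cong-* : ∀ i j m n .⦃ _ : NonZero m ⦄ .⦃ _ : NonZero n ⦄ →
           i ℤ.* + n ≡ j ℤ.* + m → i ℚ./ m ≡ j ℚ./ n
/-cong-* i j m n eq =
  ℚ.≤-antisym (/-mono-≤ i j m n (ℤ.≤-reflexive eq)) (/-mono-≤ j i n m (ℤ.≤-reflexive (sym eq)))

/-distrib-+ : ∀ i j d .⦃ _ : NonZero d ⦄ → (i ℤ.+ j) ℚ./ d ≡ i ℚ./ d ℚ.+ j ℚ./ d
/-distrib-+ i j (suc d) = ℚ.toℚᵘ-injective (begin
  toℚᵘ (fromℚᵘ (mkℚᵘ (i ℤ.+ j) d))                          ≈⟨ ℚ.toℚᵘ-fromℚᵘ (mkℚᵘ (i ℤ.+ j) d) ⟩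
  mkℚᵘ (i ℤ.+ j) d                                          ≈⟨ *≡* (numerators i j (+ suc d)) ⟩
  mkℚᵘ i d ℚᵘ.+ mkℚᵘ j d                                    ≈⟨ ℚᵘ.+-cong (ℚ.toℚᵘ-fromℚᵘ (mkℚᵘ i d)) (ℚ.toℚᵘ-fromℚᵘ (mkℚᵘ j d)) ⟨
  toℚᵘ (fromℚᵘ (mkℚᵘ i d)) ℚᵘ.+ toℚᵘ (fromℚᵘ (mkℚᵘ j d))    ≈⟨ ℚ.toℚᵘ-homo-+ (i ℚ./ suc d) (j ℚ./ suc d) ⟨
  toℚᵘ (i ℚ./ suc d ℚ.+ j ℚ./ suc d)                        ∎)
  where
  open import Relation.Binary.Reasoning.Setoid ℚᵘ.≃-setoid
  numerators : ∀ i j d → (i ℤ.+ j) ℤ.* (d ℤ.* d) ≡ (i ℤ.* d ℤ.+ j ℤ.* d) ℤ.* d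
  numerators = solve 3 (λ i j d → (i :+ j) :* (d :* d) := (i :* d :+ j :* d) :* d) refl
    where open ℤ-Solver.+-*-Solver

n<2^n : ∀ n → n ℕ.< 2 ^ n
n<2^n zero    = ℕ.z<s
n<2^n (suc n) = ℕ.+-mono-≤ (ℕ.>-nonZero⁻¹ (2 ^ n) ⦃ ℕ.m^n≢0 2 n ⦄)
                           (ℕ.m≤n⇒m≤n+o 0 (n<2^n n))

-- The number -n + k/2ⁿ, in the very form used by `dyadicPartition`, so that its points are
-- `ratᴿ (grid n k)` by definition.
grid : ℕ → ℕ → ℚ
grid n k = dyadic (+ k ℤ.- + (n ℕ.* 2 ^ n)) n

cells : ℕ → ℕ
cells n = 2 ℕ.* (n ℕ.* 2 ^ n)

grid-suc : ∀ n k → grid n (suc k) ≡ grid n k ℚ.+ dyadic (+ 1) n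
grid-suc n k = trans (cong (λ i → dyadic i n) (shift (+ k) (+ (n ℕ.* 2 ^ n))))
  (/-distrib-+ (+ k ℤ.- + (n ℕ.* 2 ^ n)) (+ 1) (2 ^ n) ⦃ ℕ.m^n≢0 2 n ⦄)
  where
  shift : ∀ i j → + 1 ℤ.+ i ℤ.- j ≡ i ℤ.- j ℤ.+ + 1
  shift = solve 2 (λ i j → con (+ 1) :+ i :- j := i :- j :+ con (+ 1)) refl
    where open ℤ-Solver.+-*-Solver

grid-< : ∀ n k → grid n k ℚ.< grid n (suc k)
grid-< n k = dyadic-mono-< n (ℤ.+-monoˡ-< (ℤ.- (+ (n ℕ.* 2 ^ n))) (ℤ.+<+ (ℕ.n<1+n k)))

-- The index at level n + 1 of the point with index `k` at level n. Halving doubles the index, and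
-- the finer grid starts one unit further left, which is `2 ^ suc n` cells.
refine : ℕ → ℕ → ℕ
refine n k = 2 ℕ.* k ℕ.+ 2 ^ suc n

refine-suc : ∀ n k → refine n (suc k) ≡ suc (suc (refine n k))
refine-suc n k = cong (λ m → suc m ℕ.+ 2 ^ suc n) (ℕ.+-suc k (k ℕ.+ 0))

grid-refine : ∀ n k → grid (suc n) (refine n k) ≡ grid n k
grid-refine n k = /-cong-*
  (+ refine n k ℤ.- + (suc n ℕ.* 2 ^ suc n)) (+ k ℤ.- + (n ℕ.* 2 ^ n)) (2 ^ suc n) (2 ^ n)
  ⦃ ℕ.m^n≢0 2 (suc n) ⦄ ⦃ ℕ.m^n≢0 2 n ⦄ (cross n k (2 ^ n))
  where
  cross : ∀ n k d → (+ (2 ℕ.* k ℕ.+ 2 ℕ.* d) ℤ.- + (suc n ℕ.* (2 ℕ.* d))) ℤ.* + d ≡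
                    (+ k ℤ.- + (n ℕ.* d)) ℤ.* + (2 ℕ.* d)
  cross n k d = begin
    (+ (2 ℕ.* k ℕ.+ 2 ℕ.* d) ℤ.- + (suc n ℕ.* (2 ℕ.* d))) ℤ.* + d
      ≡⟨ cong₂ (λ i j → (i ℤ.- j) ℤ.* + d)
           (cong₂ ℤ._+_ (ℤ.pos-* 2 k) (ℤ.pos-* 2 d))
           (trans (ℤ.pos-* (suc n) (2 ℕ.* d)) (cong (+ suc n ℤ.*_) (ℤ.pos-* 2 d))) ⟩
    (+ 2 ℤ.* + k ℤ.+ + 2 ℤ.* + d ℤ.- (+ 1 ℤ.+ + n) ℤ.* (+ 2 ℤ.* + d)) ℤ.* + d
      ≡⟨ rearrange (+ n) (+ k) (+ d) ⟩
    (+ k ℤ.- + n ℤ.* + d) ℤ.* (+ 2 ℤ.* + d)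
      ≡⟨ cong₂ (λ i j → (+ k ℤ.- i) ℤ.* j) (ℤ.pos-* n d) (ℤ.pos-* 2 d) ⟨
    (+ k ℤ.- + (n ℕ.* d)) ℤ.* + (2 ℕ.* d)
      ∎
    where
    open ≡-Reasoning
    rearrange : ∀ n k d → (+ 2 ℤ.* k ℤ.+ + 2 ℤ.* d ℤ.- (+ 1 ℤ.+ n) ℤ.* (+ 2 ℤ.* d)) ℤ.* d ≡
                          (k ℤ.- n ℤ.* d) ℤ.* (+ 2 ℤ.* d)
    rearrange = solve 3 (λ n k d →
        (con (+ 2) :* k :+ con (+ 2) :* d :- (con (+ 1) :+ n) :* (con (+ 2) :* d)) :* d :=
        (k :- n :* d) :* (con (+ 2) :* d)) refl
      where open ℤ-Solver.+-*-Solver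

refine-< : ∀ n {k} → k ℕ.< cells n → suc (refine n k) ℕ.< cells (suc n)
refine-< n {k} k<N = begin-strict
  suc (refine n k)                                  <⟨ ℕ.n<1+n (suc (refine n k)) ⟩
  suc (suc (refine n k))                            ≡⟨ refine-suc n k ⟨
  2 ℕ.* suc k ℕ.+ 2 ^ suc n                         ≤⟨ ℕ.+-monoˡ-≤ (2 ^ suc n) (ℕ.*-monoʳ-≤ 2 k<N) ⟩
  -- The finer grid gains `2 ^ suc n` cells on each side; `refine` shifts past the left ones only.
  2 ℕ.* cells n ℕ.+ 2 ^ suc n                       ≤⟨ ℕ.+-monoʳ-≤ (2 ℕ.* cells n) (ℕ.m≤n*m (2 ^ suc n) 2) ⟩
  2 ℕ.* cells n ℕ.+ 2 ℕ.* 2 ^ suc n                 ≡⟨ rearrange n (2 ^ n) ⟩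
  cells (suc n)                                     ∎
  where
  open ℕ.≤-Reasoning
  rearrange : ∀ n d → 2 ℕ.* (2 ℕ.* (n ℕ.* d)) ℕ.+ 2 ℕ.* (2 ℕ.* d) ≡ 2 ℕ.* (suc n ℕ.* (2 ℕ.* d))
  rearrange = solve 2 (λ n d → con 2 :* (con 2 :* (n :* d)) :+ con 2 :* (con 2 :* d) :=
                               con 2 :* ((con 1 :+ n) :* (con 2 :* d))) refl
    where open ℕ-Solver.+-*-Solver

-- A positive rational with denominator d is at least 1/d, and d ≤ n < 2ⁿ.
dyadic-small : ∀ ε .⦃ _ : ℚ.Positive ε ⦄ {n} → ↧ₙ ε ≤ n → dyadic (+ 1) n ℚ.≤ ε
dyadic-small ε@(mkℚ (+ suc a) d _) {n} d≤n = subst (dyadic (+ 1) n ℚ.≤_) (ℚ.↥p/↧p≡p ε)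
  (/-mono-≤ (+ 1) (+ suc a) (2 ^ n) (suc d) ⦃ ℕ.m^n≢0 2 n ⦄
    (subst₂ ℤ._≤_ (ℤ.pos-* 1 (suc d)) (ℤ.pos-* (suc a) (2 ^ n)) (ℤ.+≤+ (begin
      1 ℕ.* suc d       ≡⟨ ℕ.*-identityˡ (suc d) ⟩
      suc d             ≤⟨ d≤n ⟩
      n                 ≤⟨ ℕ.<⇒≤ (n<2^n n) ⟩
      2 ^ n             ≤⟨ ℕ.m≤n*m (2 ^ n) (suc a) ⟩
      suc a ℕ.* 2 ^ n   ∎))))
  where open ℕ.≤-Reasoning

∣i∣≤n⇒i≤n : ∀ i {n} → ℤ.∣ i ∣ ≤ n → i ℤ.≤ + n
∣i∣≤n⇒i≤n (+ m)    m≤n = ℤ.+≤+ m≤n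
∣i∣≤n⇒i≤n -[1+ m ] _   = ℤ.-≤+

∣i∣≤n⇒-n≤i : ∀ i {n} → ℤ.∣ i ∣ ≤ n → ℤ.- + n ℤ.≤ i
∣i∣≤n⇒-n≤i (+ m)    _   = ℤ.neg-≤-pos
∣i∣≤n⇒-n≤i -[1+ m ] m<n = ℤ.neg-mono-≤ (ℤ.+≤+ m<n)

-- A fraction is no larger in absolute value than its numerator, and the grid starts at -n.
grid-first : ∀ p {n} → ℤ.∣ ↥ p ∣ ≤ n → grid n 0 ℚ.≤ p
grid-first p {n} p≤n = subst (grid n 0 ℚ.≤_) (ℚ.↥p/↧p≡p p)
  (/-mono-≤ (+ 0 ℤ.- + (n ℕ.* 2 ^ n)) (↥ p) (2 ^ n) (↧ₙ p) ⦃ ℕ.m^n≢0 2 n ⦄ (begin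
    (+ 0 ℤ.- + (n ℕ.* 2 ^ n)) ℤ.* + ↧ₙ p   ≡⟨ cong (ℤ._* + ↧ₙ p) (ℤ.+-identityˡ (ℤ.- + (n ℕ.* 2 ^ n))) ⟩
    ℤ.- + (n ℕ.* 2 ^ n) ℤ.* + ↧ₙ p         ≡⟨ ℤ.neg-distribˡ-* (+ (n ℕ.* 2 ^ n)) (+ ↧ₙ p) ⟨
    ℤ.- (+ (n ℕ.* 2 ^ n) ℤ.* + ↧ₙ p)       ≡⟨ cong ℤ.-_ (ℤ.pos-* (n ℕ.* 2 ^ n) (↧ₙ p)) ⟨
    ℤ.- + (n ℕ.* 2 ^ n ℕ.* ↧ₙ p)           ≤⟨ ℤ.neg-mono-≤ (ℤ.+≤+ (ℕ.m≤m*n (n ℕ.* 2 ^ n) (↧ₙ p))) ⟩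
    ℤ.- + (n ℕ.* 2 ^ n)                    ≡⟨ cong ℤ.-_ (ℤ.pos-* n (2 ^ n)) ⟩
    ℤ.- (+ n ℤ.* + (2 ^ n))                ≡⟨ ℤ.neg-distribˡ-* (+ n) (+ (2 ^ n)) ⟩
    ℤ.- + n ℤ.* + (2 ^ n)                  ≤⟨ ℤ.*-monoʳ-≤-nonNeg (+ (2 ^ n)) (∣i∣≤n⇒-n≤i (↥ p) p≤n) ⟩
    ↥ p ℤ.* + (2 ^ n)                      ∎))
  where open ℤ.≤-Reasoning

grid-last : ∀ p {n} → ℤ.∣ ↥ p ∣ ≤ n → p ℚ.≤ grid n (cells n)
grid-last p {n} p≤n = subst (ℚ._≤ grid n (cells n)) (ℚ.↥p/↧p≡p p)
  (/-mono-≤ (↥ p) (+ cells n ℤ.- + m) (↧ₙ p) (2 ^ n) ⦃ _ ⦄ ⦃ ℕ.m^n≢0 2 n ⦄ (begin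
    ↥ p ℤ.* + (2 ^ n)                      ≤⟨ ℤ.*-monoʳ-≤-nonNeg (+ (2 ^ n)) (∣i∣≤n⇒i≤n (↥ p) p≤n) ⟩
    + n ℤ.* + (2 ^ n)                      ≡⟨ ℤ.pos-* n (2 ^ n) ⟨
    + m                                    ≤⟨ ℤ.+≤+ (ℕ.m≤m*n m (↧ₙ p)) ⟩
    + (m ℕ.* ↧ₙ p)                         ≡⟨ ℤ.pos-* m (↧ₙ p) ⟩
    + m ℤ.* + ↧ₙ p                         ≡⟨ cong (ℤ._* + ↧ₙ p) (double (+ m)) ⟨
    (+ 2 ℤ.* + m ℤ.- + m) ℤ.* + ↧ₙ p       ≡⟨ cong (λ i → (i ℤ.- + m) ℤ.* + ↧ₙ p) (ℤ.pos-* 2 m) ⟨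
    (+ (2 ℕ.* m) ℤ.- + m) ℤ.* + ↧ₙ p       ∎))
  where
  open ℤ.≤-Reasoning
  m = n ℕ.* 2 ^ n
  double : ∀ i → + 2 ℤ.* i ℤ.- i ≡ i
  double = solve 1 (λ i → con (+ 2) :* i :- i := i) refl
    where open ℤ-Solver.+-*-Solver

open ℝ using (Lower; Upper; lowerRounded; upperRounded)

-- Dyadic cells

_⊑_ : Interval → Interval → Set₁
_⊑_ = Poset._≤_ 𝐈ℝ

UpwardClosed : Pred Interval 0ℓ → Set₁
UpwardClosed C = ∀ {J K} → J ⊑ K → J ∈ C → K ∈ C

endpoints⇒⊑ : ∀ {J K} → lo J ≤ᴿ lo K → hi K ≤ᴿ hi J → J ⊑ K
endpoints⇒⊑ J≤K K≤J z (K≤z , z≤K) = (λ q → K≤z q ∘ J≤K q) , (λ q → K≤J q ∘ z≤K q)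

cell⇒⊑ι : ∀ J {x} → x ∈ cell J → J ⊑ ι x
cell⇒⊑ι J {x} (J<x , x≤J) = endpoints⇒⊑ {J} {ι x} (<⇒≤ᴿ {lo J} {x} J<x) x≤J

covered⊆ι⁻¹ : ∀ C → UpwardClosed C → ∀ Js → covered C Js ⊆ ι ⊢ C
covered⊆ι⁻¹ C up (J ∷ Js) {x} (inj₁ (J∈C , x∈J)) = up {J} {ι x} (cell⇒⊑ι J {x} x∈J) J∈C
covered⊆ι⁻¹ C up (J ∷ Js) (inj₂ x∈Js)        = covered⊆ι⁻¹ C up Js x∈Js

ratᴿ-mono-≤ : ∀ {p q} → p ℚ.≤ q → ratᴿ p ≤ᴿ ratᴿ q
ratᴿ-mono-≤ p≤q r r<p = ℚ.<-≤-trans r<p p≤q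

dyadicCells : ℕ → List Interval
dyadicCells n = consecutive (Partition.increasing (dyadicPartition n))

-- The cell of index k belongs to C, stated without reference to the proof
-- component of an interval.
SubintervalsIn : Pred Interval 0ℓ → ℚ → ℚ → Set₁
SubintervalsIn C p q = ∀ J → ratᴿ p ≤ᴿ lo J → hi J ≤ᴿ ratᴿ q → J ∈ C

dyadicCovered⁻ : ∀ C → UpwardClosed C → ∀ n {x} → x ∈ covered C (dyadicCells n) →
  ∃ λ k → k ℕ.< cells n × SubintervalsIn C (grid n k) (grid n (suc k)) ×
          x ∈ ] ratᴿ (grid n k) , ratᴿ (grid n (suc k)) ]
dyadicCovered⁻ C up n {x} x∈ =
  let k , k<N , K∈C , x∈K = covered-applyUpTo⁻ C {x} (ratᴿ ∘ grid n) (cells n) _ x∈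
      K = interval (ratᴿ (grid n k)) (ratᴿ (grid n (suc k)))
            (<⇒≤ᴿ {ratᴿ (grid n k)} {ratᴿ (grid n (suc k))} (ratᴿ-mono-< (grid-< n k)))
  in k , k<N , (λ J K≤J J≤K → up {K} {J} (endpoints⇒⊑ {K} {J} K≤J J≤K) K∈C) , x∈K

dyadicCovered⁺ : ∀ C n {x k} → k ℕ.< cells n → SubintervalsIn C (grid n k) (grid n (suc k)) →
  x ∈ ] ratᴿ (grid n k) , ratᴿ (grid n (suc k)) ] → x ∈ covered C (dyadicCells n)
dyadicCovered⁺ C n {x} {k} k<N in-C x∈ =
  covered-applyUpTo⁺ C {x} (ratᴿ ∘ grid n) (cells n) _ k<N
    (in-C (interval (ratᴿ (grid n k)) (ratᴿ (grid n (suc k))) _) (λ _ → id) (λ _ → id)) x∈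

module _ (em : ∀ {ℓ} → ExcludedMiddle ℓ) where

  ≤ᴿ-or-> : ∀ x b → x ≤ᴿ b ⊎ b <ᴿ x
  ≤ᴿ-or-> x b with em {P = b <ᴿ x}
  ... | yes b<x = inj₂ b<x
  ... | no  b≮x = inj₁ (Equivalence.from (≤ᴿ⇔≯ᴿ {x} {b}) b≮x)

  dyadicCovered-step : ∀ C → UpwardClosed C → ∀ n →
                       covered C (dyadicCells n) ⊆ covered C (dyadicCells (suc n))
  dyadicCovered-step C up n {x} x∈ with dyadicCovered⁻ C up n {x} x∈
  ... | k , k<N , in-C , k<x , x≤k+1 = halves (≤ᴿ-or-> x (ratᴿ (g (suc r))))
    where
    g = grid (suc n)
    r = refine n k
    left : grid n k ≡ g r
    left = sym (grid-refine n k)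
    right : grid n (suc k) ≡ g (suc (suc r))
    right = trans (sym (grid-refine n (suc k))) (cong g (refine-suc n k))
    in-C′ : SubintervalsIn C (g r) (g (suc (suc r)))
    in-C′ = subst₂ (SubintervalsIn C) left right in-C
    -- `g (suc r)` is the midpoint of the coarse cell; as cells contain their right ends, it falls
    -- to the left half.
    halves : x ≤ᴿ ratᴿ (g (suc r)) ⊎ ratᴿ (g (suc r)) <ᴿ x → x ∈ covered C (dyadicCells (suc n))
    halves (inj₁ x≤mid) = dyadicCovered⁺ C (suc n) {x} (ℕ.<-trans (ℕ.n<1+n r) (refine-< n k<N))
      (λ J r≤J J≤mid → in-C′ J r≤J
        (λ q q<J → ℚ.<-trans (J≤mid q q<J) (grid-< (suc n) (suc r))))
      (subst (λ p → ratᴿ p <ᴿ x) left k<x , x≤mid)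
    halves (inj₂ mid<x) = dyadicCovered⁺ C (suc n) {x} (refine-< n k<N)
      (λ J mid≤J J≤end → in-C′ J (λ q q<r → mid≤J q (ℚ.<-trans q<r (grid-< (suc n) r))) J≤end)
      (mid<x , subst (λ p → x ≤ᴿ ratᴿ p) right x≤k+1)

  dyadicCovered-mono : ∀ C → UpwardClosed C → ∀ {m n} → m ≤ n →
                       covered C (dyadicCells m) ⊆ covered C (dyadicCells n)
  dyadicCovered-mono C up m≤n = go (ℕ.≤⇒≤′ m≤n)
    where
    go : ∀ {m n} → m ℕ.≤′ n → covered C (dyadicCells m) ⊆ covered C (dyadicCells n)
    go (ℕ.≤′-reflexive refl) x∈ = x∈
    go {n = suc n} (ℕ.≤′-step m≤n) {x} x∈ = dyadicCovered-step C up n {x} (go m≤n {x} x∈)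

  -- Descending from the right end, the search stops at the first `f k` strictly below `x`; `f 0` is
  -- one at the latest.
  locate : ∀ (f : ℕ → ℝ) {x} → f 0 <ᴿ x → ∀ N → x ≤ᴿ f N →
           ∃ λ k → k ℕ.< N × x ∈ ] f k , f (suc k) ]
  locate f {x} f0<x zero x≤f0 = ⊥-elim (Equivalence.to (≤ᴿ⇔≯ᴿ {x} {f 0}) x≤f0 f0<x)
  locate f {x} f0<x (suc N) x≤fN+1 with ≤ᴿ-or-> x (f N)
  ... | inj₂ fN<x = N , ℕ.n<1+n N , fN<x , x≤fN+1
  ... | inj₁ x≤fN = let k , k<N , x∈ = locate f {x} f0<x N x≤fN in k , ℕ.m<n⇒m<1+n k<N , x∈

  -- Rationals p < p′ < x < q′ < q leave margins on both sides. Once the mesh is at most both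
  -- margins, the cell around `x`, which ends after p′ and begins before q′, fits between p and q.
  dyadicCells-exhaust : ∀ C x {p q} → p ∈ Lower x → q ∈ Upper x → SubintervalsIn C p q →
                        ∃ λ n → x ∈ covered C (dyadicCells n)
  dyadicCells-exhaust C x {p} {q} p∈x q∈x in-C =
    let p′ , p<p′ , p′∈x = Equivalence.to (lowerRounded x) p∈x
        q′ , q′<q , q′∈x = Equivalence.to (upperRounded x) q∈x
        instance
          pos₁ : ℚ.Positive (p′ ℚ.- p)
          pos₁ = ℚ.positive (difference-positive p<p′)
          pos₂ : ℚ.Positive (q ℚ.- q′)
          pos₂ = ℚ.positive (difference-positive q′<q)
        a = ↧ₙ (p′ ℚ.- p)
        b = ↧ₙ (q ℚ.- q′)
        c = ℤ.∣ ↥ p ∣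
        d = ℤ.∣ ↥ q ∣
        -- The denominators of the margins make the mesh fine enough; the numerators of `p` and `q`
        -- make the grid reach around both.
        n = (a ℕ.⊔ b) ℕ.⊔ (c ℕ.⊔ d)
        a⊔b≤n = ℕ.m≤m⊔n (a ℕ.⊔ b) (c ℕ.⊔ d)
        c⊔d≤n = ℕ.m≤n⊔m (a ℕ.⊔ b) (c ℕ.⊔ d)
        first≤p = grid-first p {n} (ℕ.≤-trans (ℕ.m≤m⊔n c d) c⊔d≤n)
        q≤last  = grid-last q {n} (ℕ.≤-trans (ℕ.m≤n⊔m c d) c⊔d≤n)
        ε≤p′-p  = dyadic-small (p′ ℚ.- p) {n} (ℕ.≤-trans (ℕ.m≤m⊔n a b) a⊔b≤n)
        ε≤q-q′  = dyadic-small (q ℚ.- q′) {n} (ℕ.≤-trans (ℕ.m≤n⊔m a b) a⊔b≤n)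
        k , k<N , k<x , x≤k+1 = locate (ratᴿ ∘ grid n) {x}
          (p′ , ℚ.≤-<-trans first≤p p<p′ , p′∈x) (cells n)
          (λ r r∈x → ℚ.<-≤-trans (lower<upper x r∈x q∈x) q≤last)
    in n , dyadicCovered⁺ C n {x} k<N
             (λ J k≤J J≤k+1 → in-C J
               (λ r r<p → k≤J r (ℚ.<-≤-trans r<p (left-bound n k p p′ ε≤p′-p (x≤k+1 p′ p′∈x))))
               (λ r r∈J → ℚ.<-≤-trans (J≤k+1 r r∈J) (right-bound n k q q′ ε≤q-q′ (grid<upper k<x q′∈x))))
             (k<x , x≤k+1)
    where
    difference-positive : ∀ {p q} → p ℚ.< q → 0ℚ ℚ.< q ℚ.- p
    difference-positive {p} {q} p<q =
      subst (ℚ._< q ℚ.- p) (ℚ.+-inverseʳ p) (ℚ.+-monoˡ-< (ℚ.- p) p<q)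

    grid<upper : ∀ {p q} → ratᴿ p <ᴿ x → q ∈ Upper x → p ℚ.< q
    grid<upper (_ , p<r , r∈x) q∈x = ℚ.<-trans p<r (lower<upper x r∈x q∈x)

    left-bound : ∀ n k p p′ → dyadic (+ 1) n ℚ.≤ p′ ℚ.- p → p′ ℚ.< grid n (suc k) → p ℚ.≤ grid n k
    left-bound n k p p′ ε≤p′-p p′<k+1 = subst₂ ℚ._≤_ (eq₁ p p′) (eq₂ (grid n k) (dyadic (+ 1) n))
      (ℚ.+-mono-≤ (ℚ.<⇒≤ (subst (p′ ℚ.<_) (grid-suc n k) p′<k+1)) (ℚ.neg-antimono-≤ ε≤p′-p))
      where
      open ℚ-Solver.+-*-Solver
      eq₁ : ∀ p p′ → p′ ℚ.- (p′ ℚ.- p) ≡ p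
      eq₁ = solve 2 (λ p p′ → p′ :- (p′ :- p) := p) refl
      eq₂ : ∀ g ε → (g ℚ.+ ε) ℚ.- ε ≡ g
      eq₂ = solve 2 (λ g ε → (g :+ ε) :- ε := g) refl

    right-bound : ∀ n k q q′ → dyadic (+ 1) n ℚ.≤ q ℚ.- q′ → grid n k ℚ.< q′ → grid n (suc k) ℚ.≤ q
    right-bound n k q q′ ε≤q-q′ k<q′ = subst₂ ℚ._≤_ (sym (grid-suc n k)) (eq q q′)
      (ℚ.+-mono-≤ (ℚ.<⇒≤ k<q′) ε≤q-q′)
      where
      open ℚ-Solver.+-*-Solver
      eq : ∀ q q′ → q′ ℚ.+ (q ℚ.- q′) ≡ q
      eq = solve 2 (λ q q′ → q′ :+ (q :- q′) := q) refl

-- ι x is the directed supremum of the rational intervals around x.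

rational-neighbourhood : ∀ ((C , _) : ScottOpen 𝐈ℝ) x → ι x ∈ C →
  ∃₂ λ p q → p ∈ Lower x × q ∈ Upper x × SubintervalsIn C p q
rational-neighbourhood (C , C-open) x ιx∈C =
  let lift (p , q , p∈x , q∈x) , pq∈C = inaccessible directed lub ιx∈C
  in p , q , p∈x , q∈x , λ J p≤J J≤q →
       upward (endpoints⇒⊑ {around (lift (p , q , p∈x , q∈x))} {J} p≤J J≤q) pq∈C
  where
  open IsScottOpen C-open
  open ℝ using (lowerInhabited; upperInhabited)

  Around : Set₁
  Around = Lift (lsuc 0ℓ) (∃₂ λ p q → p ∈ Lower x × q ∈ Upper x)

  around : Around → Interval
  around (lift (p , q , p∈x , q∈x)) = interval (ratᴿ p) (ratᴿ q)
    (ratᴿ-mono-≤ (ℚ.<⇒≤ (lower<upper x p∈x q∈x)))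

  directed : IsDirected 𝐈ℝ around
  directed = record
    { inhabitant = lift (_ , _ , proj₂ (lowerInhabited x) , proj₂ (upperInhabited x))
    ; bound      = λ { (lift (p , q , p∈x , q∈x)) (lift (p′ , q′ , p′∈x , q′∈x)) →
        let J = around (lift (p , q , p∈x , q∈x))
            J′ = around (lift (p′ , q′ , p′∈x , q′∈x))
            m = lift (p ℚ.⊔ p′ , q ℚ.⊓ q′ , ⊔∈ p∈x p′∈x , ⊓∈ q∈x q′∈x)
        in m
         , endpoints⇒⊑ {J} {around m} (ratᴿ-mono-≤ (ℚ.p≤p⊔q p p′)) (ratᴿ-mono-≤ (ℚ.p⊓q≤p q q′))
         , endpoints⇒⊑ {J′} {around m} (ratᴿ-mono-≤ (ℚ.p≤q⊔p p p′)) (ratᴿ-mono-≤ (ℚ.p⊓q≤q q q′)) }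
    }
    where
    ⊔∈ : ∀ {p q} → p ∈ Lower x → q ∈ Lower x → p ℚ.⊔ q ∈ Lower x
    ⊔∈ {p} {q} p∈x q∈x with ℚ.⊔-sel p q
    ... | inj₁ eq = subst (Lower x) (sym eq) p∈x
    ... | inj₂ eq = subst (Lower x) (sym eq) q∈x
    ⊓∈ : ∀ {p q} → p ∈ Upper x → q ∈ Upper x → p ℚ.⊓ q ∈ Upper x
    ⊓∈ {p} {q} p∈x q∈x with ℚ.⊓-sel p q
    ... | inj₁ eq = subst (Upper x) (sym eq) p∈x
    ... | inj₂ eq = subst (Upper x) (sym eq) q∈x

  lub : IsLub 𝐈ℝ around (ι x)
  lub = record
    { upper = λ { (lift (p , q , p∈x , q∈x)) → endpoints⇒⊑ {around (lift (p , q , p∈x , q∈x))} {ι x}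
        (λ r r<p → Equivalence.from (lowerRounded x) (p , r<p , p∈x))
        (λ r r∈x → lower<upper x r∈x q∈x) }
    ; least = λ {J} around⊑J z z∈J →
        (λ r r∈x →
          let s , r<s , s∈x = Equivalence.to (lowerRounded x) r∈x
              q , q∈x = upperInhabited x
          in proj₁ (around⊑J (lift (s , q , s∈x , q∈x)) z z∈J) r r<s)
      -- A rational `s` strictly between `x` and `z` would end an interval around `x` that still has
      -- to contain `z`.
      , Equivalence.from (≤ᴿ⇔≯ᴿ {z} {x}) (λ (s , s∈x , s∈z) →
          let p , p∈x = lowerInhabited x
          in ℚ.<-irrefl refl (proj₂ (around⊑J (lift (p , s , p∈x , s∈x)) z z∈J) s s∈z))
    }

-- Images in a poset that receives 𝐈ℝ by a Scott-continuous map

preimage : {X : Poset (lsuc 0ℓ) ℓ₁ ℓ₂} {e : Interval → Poset.Carrier X} →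
           IsScottContinuous 𝐈ℝ X e → ScottOpen X → ScottOpen 𝐈ℝ
preimage {e = e} e-continuous (V , V-open) = e ⊢ V , record
  { upward       = λ J⊑K → upward (mono J⊑K)
  ; inaccessible = λ dir lub → inaccessible
      (record { inhabitant = IsDirected.inhabitant dir
              ; bound = λ k l → let m , k≤m , l≤m = IsDirected.bound dir k l
                                in m , mono k≤m , mono l≤m })
      (preservesLub dir lub)
  }
  where
  open IsScottOpen V-open
  open IsScottContinuous e-continuous

module _ (em : ∀ {ℓ} → ExcludedMiddle ℓ) (μ : Measure) {X : Poset (lsuc 0ℓ) ℓ₁ ℓ₂}
         {e : Interval → Poset.Carrier X} (e-continuous : IsScottContinuous 𝐈ℝ X e)
         (ι-e-continuous : IsContinuousᴿ X (e ∘ ι)) where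

  private
    ν : SetFunction X
    ν = image (e ∘ ι) ι-e-continuous μ

    νₙ : ℕ → SetFunction X
    νₙ n = approximation e μ (dyadicPartition n)

    terms : ℕ → List ([0,∞] × Poset.Carrier X)
    terms n = map (λ J → measure μ (cellᴮ J) , e J) (dyadicCells n)

    W : ScottOpen X → ℕ → BorelSet
    W V n = coveredᴮ em (e ⊢ proj₁ V) (dyadicCells n)

    e⁻¹-upward : ∀ V → UpwardClosed (e ⊢ proj₁ V)
    e⁻¹-upward V = IsScottOpen.upward (proj₂ (preimage {X = X} e-continuous V))

    W-mono : ∀ V {m n} → m ≤ n → proj₁ (W V m) ⊆ proj₁ (W V n)
    W-mono V = dyadicCovered-mono em (e ⊢ proj₁ V) (e⁻¹-upward V)

    ⋃W : ∀ V → proj₁ (⋃ᴮ (W V)) ≐ (e ∘ ι) ⊢ proj₁ V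
    ⋃W V = (λ (n , x∈) → covered⊆ι⁻¹ (e ⊢ proj₁ V) (e⁻¹-upward V) (dyadicCells n) x∈)
         , (λ {x} x∈V →
             let p , q , p∈x , q∈x , in-V = rational-neighbourhood (preimage {X = X} e-continuous V) x x∈V
             in dyadicCells-exhaust em (e ⊢ proj₁ V) x p∈x q∈x in-V)

    νₙ≈μ : ∀ n V → νₙ n V ≈∞ measure μ (W V n)
    νₙ≈μ n V = linearCombination-measure em {X = X} e μ
      (consecutive-separated (Partition.increasing (dyadicPartition n))) V

    νₙ-mono : ∀ {m n} → m ≤ n → ∀ V → νₙ m V ≤∞ νₙ n V
    νₙ-mono {m} {n} m≤n V q q∈ =
      proj₂ (νₙ≈μ n V) q (measure-mono μ em (W V m) (W V n) (W-mono V m≤n) q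
        (proj₁ (νₙ≈μ m V) q q∈))

    νₙ-lub : ∀ V → IsLub [0,∞]-poset (λ n → νₙ n V) (ν V)
    νₙ-lub V = record
      { upper = λ n q q∈ → proj₁ ⋃W≈ν q (IsLub.upper lub n q (proj₁ (νₙ≈μ n V) q q∈))
      ; least = λ {t} νₙ≤t q q∈ → IsLub.least lub {t}
          (λ n p p∈ → νₙ≤t n p (proj₂ (νₙ≈μ n V) p p∈)) q (proj₂ ⋃W≈ν q q∈)
      }
      where
      ⋃W≈ν : measure μ (⋃ᴮ (W V)) ≈∞ ν V
      -- The union and the open set carry different proofs of being Borel; `measure-cong` looks only
      -- at the underlying sets.
      ⋃W≈ν = measure-cong μ {⋃ᴮ (W V)} {_ , open-set (ι-e-continuous V)} (⋃W V)
      lub : IsLub [0,∞]-poset (measure μ ∘ W V) (measure μ (⋃ᴮ (W V)))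
      lub = measure-⋃-chain μ em (W V) (W-mono V)

  -- One argument serves both targets: since `e` is Scott-continuous, pulling `V` back along it
  -- leaves a Scott-open set of 𝐈ℝ, where all the geometry takes place.
  image-isSupremum :
    Σ[ ν-val ∈ IsContinuousValuation X (image (e ∘ ι) ι-e-continuous μ) ]
    Σ[ νₙ-val ∈ (∀ n → IsContinuousValuation X (approximation e μ (dyadicPartition n))) ]
      let ν : Poset.Carrier (𝐕 X)
          ν = image (e ∘ ι) ι-e-continuous μ , ν-val
          νₙ : ℕ → Poset.Carrier (𝐕 X)
          νₙ = λ n → approximation e μ (dyadicPartition n) , νₙ-val n
      in IsMinimal ν
         × (∀ m n → m ≤ n → Poset._≤_ (𝐕 X) (νₙ m) (νₙ n))
         × IsLub (𝐕 X) νₙ ν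
  image-isSupremum =
      ν-val , νₙ-val
    , directedSup (λ (lift n) → νₙ n , νₙ-val n)
        (record
          { inhabitant = lift 0
          ; bound      = λ (lift m) (lift n) → lift (m ℕ.⊔ n)
              , νₙ-mono (ℕ.m≤m⊔n m n) , νₙ-mono (ℕ.m≤n⊔m m n)
          })
        (pointwise-lub λ V → record
          { upper = λ (lift n) → IsLub.upper (νₙ-lub V) n
          ; least = λ {t} νₙ≤t → IsLub.least (νₙ-lub V) {t} (λ n → νₙ≤t (lift n)) })
        (λ (lift n) → linearCombination-isMinimal em {X = X} (terms n) (νₙ-val n))
    , (λ m n → νₙ-mono)
    , pointwise-lub νₙ-lub
    where
    νₙ-val : ∀ n → IsContinuousValuation X (νₙ n)
    νₙ-val n = linearCombination-isContinuousValuation em (terms n)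
    ν-val : IsContinuousValuation X ν
    ν-val = supremum-isContinuousValuation νₙ ν νₙ-val νₙ-mono νₙ-lub

id-continuous : IsScottContinuous 𝐈ℝ 𝐈ℝ id
id-continuous = record { mono = id ; preservesLub = λ _ lub → lub }

inj-continuous : IsScottContinuous 𝐈ℝ 𝐈ℝ⊥ inj
inj-continuous = record
  { mono         = [_]
  ; preservesLub = λ dir lub → record
      { upper = λ k → [ IsLub.upper lub k ]
      ; least = least dir lub
      }
  }
  where
  least : ∀ {I : Set₁} {g : I → Interval} {J} → IsDirected 𝐈ℝ g → IsLub 𝐈ℝ g J →
          ∀ {t} → (∀ k → Poset._≤_ 𝐈ℝ⊥ [ g k ] t) → Poset._≤_ 𝐈ℝ⊥ [ J ] t
  -- A directed family has a member, so the fresh least element cannot bound a family of intervals.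
  least {g = g} dir lub {⊥₋} g≤⊥ with g≤⊥ (IsDirected.inhabitant dir)
  ... | ()
  least {g = g} dir lub {[ K ]} g≤K = [ IsLub.least lub {K} (λ k → unwrap (g≤K k)) ]
    where
    unwrap : ∀ {J} → Poset._≤_ 𝐈ℝ⊥ [ J ] [ K ] → J ⊑ K
    unwrap [ J⊑K ] = J⊑K

corollary6p8 : (∀ {ℓ} → ExcludedMiddle ℓ) → (μ : Measure) →
    ( Σ[ ν-val ∈ IsContinuousValuation 𝐈ℝ (image ι ι-continuous μ) ]
      Σ[ νₙ-val ∈ (∀ n → IsContinuousValuation 𝐈ℝ (approximation id μ (dyadicPartition n))) ]
      let ν : Poset.Carrier (𝐕 𝐈ℝ)
          ν = image ι ι-continuous μ , ν-val
          νₙ : ℕ → Poset.Carrier (𝐕 𝐈ℝ)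
          νₙ = λ n → approximation id μ (dyadicPartition n) , νₙ-val n
      in IsMinimal ν
         × (∀ m n → m ≤ n → Poset._≤_ (𝐕 𝐈ℝ) (νₙ m) (νₙ n))
         × IsLub (𝐕 𝐈ℝ) νₙ ν )
    ×
    ( Σ[ ν-val ∈ IsContinuousValuation 𝐈ℝ⊥ (image ι⊥ ι⊥-continuous μ) ]
      Σ[ νₙ-val ∈ (∀ n → IsContinuousValuation 𝐈ℝ⊥ (approximation inj μ (dyadicPartition n))) ]
      let ν : Poset.Carrier (𝐕 𝐈ℝ⊥)
          ν = image ι⊥ ι⊥-continuous μ , ν-val
          νₙ : ℕ → Poset.Carrier (𝐕 𝐈ℝ⊥)
          νₙ = λ n → approximation inj μ (dyadicPartition n) , νₙ-val n
      in IsMinimal ν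
         × (∀ m n → m ≤ n → Poset._≤_ (𝐕 𝐈ℝ⊥) (νₙ m) (νₙ n))
         × IsLub (𝐕 𝐈ℝ⊥) νₙ ν )
corollary6p8 em μ =
    image-isSupremum em μ id-continuous ι-continuous
  , image-isSupremum em μ inj-continuous ι⊥-continuous
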